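{- Let $n\ge1$. The poset $\mathrm{bic}(\widetilde{C}_n)$ of biclosed sets of positive roots of $\widetilde{C}_n$, ordered by containment, is a lattice.
   Context: Let $N=2n+1$ and let $V$ be the real vector space spanned by $\widetilde{e}_i$, $i\in\mathbb{Z}$, modulo $\widetilde{e}_{i+N}=\widetilde{e}_i+\widetilde{e}_N$ and $\widetilde{e}_{ -i}=-\widetilde{e}_i$. The root system of $\widetilde{C}_n$ (the affine Weyl group realized as permutations $f$ of $\mathbb{Z}$ with $f(x+N)=f(x)+N$, $f(-x)=-f(x)$) is $\{\widetilde{e}_j-\widetilde{e}_i: i,j\not\equiv0\bmod N,\ i\not\equiv j\bmod N\}$, with positive roots those with $i<j$. A set $B$ of positive roots is biclosed if for positive roots $\alpha,\beta,\gamma$ with $\gamma\in\mathbb{R}_{>0}\alpha+\mathbb{R}_{>0}\beta$: $\alpha,\beta\in B\Rightarrow\gamma\in B$ and $\alpha,\beta\notin B\Rightarrow\gamma\notin B$. -}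

module Defs where

open import Data.Nat as ℕ using (ℕ; zero; suc; _<?_; _≤?_)
open import Data.Fin using (Fin; fromℕ<)
import Data.Fin as Fin
open import Data.Integer using (ℤ; +_; _<_) renaming (_+_ to _+ℤ_; _*_ to _*ℤ_; -_ to -ℤ_)
open import Data.Integer.Divisibility using (_∣_)
open import Data.Integer.DivMod using (_/ℕ_; _%ℕ_)
open import Data.Vec using (Vec; replicate; zipWith; map; tabulate)
open import Data.Product using (Σ; _×_; ∃; ∃-syntax)
open import Relation.Nullary using (¬_; yes; no)
open import Relation.Unary using (Pred; _⊆_)
open import Relation.Binary.PropositionalEquality using (_≡_)
open import Level using (0ℓ)
open import Data.Bool using (if_then_else_)
open import Relation.Nullary.Decidable using (⌊_⌋)

N : ℕ → ℕ
N n = suc (n ℕ.+ n)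

-- Coordinates for V ≅ ℝ^{n+1} (here integer points suffice for roots):
-- coordinate 0 is δ = ẽ_N, coordinate k (1 ≤ k ≤ n) is ẽ_k.
V : ℕ → Set
V n = Vec ℤ (suc n)

_⊕_ : ∀ {n} → V n → V n → V n
_⊕_ = zipWith _+ℤ_

_⊝_ : ∀ {n} → V n → V n → V n
u ⊝ v = zipWith (λ a b → a +ℤ (-ℤ b)) u v

_·_ : ∀ {n} → ℤ → V n → V n
c · v = map (c *ℤ_) v

unit : ∀ {n} → Fin (suc n) → V n
unit k = tabulate (λ j → if ⌊ k Fin.≟ j ⌋ then + 1 else + 0)

zeroV : ∀ {n} → V n
zeroV = replicate _ (+ 0)

δ : ∀ {n} → V n
δ = unit Fin.zero

-- the vector ẽ_k for 0 ≤ k ≤ n (ẽ_0 = 0); out-of-range values are never used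
small : (n : ℕ) → ℕ → V n
small n zero = zeroV
small n (suc k) with suc k <? suc n
... | yes p = unit (fromℕ< p)
... | no _ = zeroV

ebar : (n : ℕ) → ℕ → V n
ebar n r with r ≤? n
... | yes _ = small n r
... | no _ = δ ⊝ small n (N n ℕ.∸ r)

e : (n : ℕ) → ℤ → V n
e n i = ((i /ℕ N n) · δ) ⊕ ebar n (i %ℕ N n)

PosRoot : (n : ℕ) → Pred (V n) 0ℓ
PosRoot n v = ∃[ i ] ∃[ j ] (¬ (+ N n ∣ i)) × (¬ (+ N n ∣ j)) × (¬ (+ N n ∣ (j +ℤ (-ℤ i))))
                × (i < j) × (v ≡ (e n j ⊝ e n i))

-- γ ∈ ℝ_{>0} α + ℝ_{>0} β, for integer vectors: c γ = a α + b β with a,b,c positive integers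
InCone : (n : ℕ) → V n → V n → V n → Set
InCone n γ α β = ∃[ a ] ∃[ b ] ∃[ c ] ((+ suc c) · γ ≡ (((+ suc a) · α) ⊕ ((+ suc b) · β)))

Biclosed : (n : ℕ) → Pred (V n) 0ℓ → Set
Biclosed n B =
  (B ⊆ PosRoot n)
  × (∀ α β γ → PosRoot n α → PosRoot n β → PosRoot n γ → InCone n γ α β →
       (B α → B β → B γ) × (¬ B α → ¬ B β → ¬ B γ))

IsJoin : (n : ℕ) → (B₁ B₂ J : Pred (V n) 0ℓ) → Set₁
IsJoin n B₁ B₂ J = Biclosed n J × B₁ ⊆ J × B₂ ⊆ J
  × (∀ (K : Pred (V n) 0ℓ) → Biclosed n K → B₁ ⊆ K → B₂ ⊆ K → J ⊆ K)

IsMeet : (n : ℕ) → (B₁ B₂ M : Pred (V n) 0ℓ) → Set₁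
IsMeet n B₁ B₂ M = Biclosed n M × M ⊆ B₁ × M ⊆ B₂
  × (∀ (K : Pred (V n) 0ℓ) → Biclosed n K → K ⊆ B₁ → K ⊆ B₂ → K ⊆ M)

{-# OPTIONS --safe #-}
module Submission where

-- Write i ≻ j when ẽ_j − ẽ_i with i < j is in B, or ẽ_i − ẽ_j with j < i is not; biclosedness of B forbids a
-- vanishing positive combination of three roots ẽ_x − ẽ_y, x ≻ y. Adding to B the pairs (i, i + dN) with i ≻
-- l ≻ i + dN for some l makes it cotransitive on all pairs i < j. Hence so is the transitive closure of the
-- union of two extended biclosed sets, which therefore is the set of inversions of a total order on the
-- nonzero residues, invariant under translation by N and under negation. For such an order, a Euclidean
-- descent on the coefficients again excludes vanishing positive combinations of three such roots; so the
-- inversions form a biclosed set, and its roots are (up to double negation) exactly those obtained from B₁ ∪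
-- B₂ by closing under two-dimensional cones. That closure is the join; the meet is dual. Coclosedness is a
-- negative statement, so classical case distinctions are harmless in its proof.

open import Defs
open import Data.Nat as ℕ using (ℕ; zero; suc; _≥_)
import Data.Nat.Properties as ℕ
open import Data.Fin as Fin using (Fin)
import Data.Fin.Properties as Fin
open import Data.Integer hiding (suc; _≥_)
open import Data.Integer.Properties
open import Algebra.Properties.AbelianGroup +-0-abelianGroup using () renaming (∙-cancelʳ to +-cancelʳ)
import Data.Integer.Divisibility as Unsigned
open import Data.Integer.Divisibility.Signed using (divides; _∣?_; ∣ᵤ⇒∣; ∣⇒∣ᵤ)
open import Data.Integer.DivMod using (_/ℕ_; _%ℕ_; a≡a%ℕn+[a/ℕn]*n; n%ℕd<d)
open import Data.Integer.Tactic.RingSolver using (solve-∀)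
open import Data.Vec using (Vec; []; _∷_; lookup)
open import Data.Vec.Properties using (lookup-zipWith; lookup-map; lookup-replicate; lookup∘tabulate)
open import Data.Bool using (if_then_else_)
open import Data.Product using (_×_; ∃-syntax; _,_; proj₁; proj₂)
open import Data.Sum using (_⊎_; inj₁; inj₂; [_,_]′)
open import Data.Empty using (⊥)
open import Function using (_∘_)
open import Relation.Nullary using (¬_; yes; no; contradiction)
open import Relation.Nullary.Decidable using (⌊_⌋)
open import Relation.Unary using (Pred; _⊆_)
open import Relation.Binary.Definitions using (tri<; tri≈; tri>)
open import Relation.Binary.PropositionalEquality
open import Level using (0ℓ)

-- Congruence modulo N and the abstract coordinate data.

infix 4 _≡_[mod_]
record _≡_[mod_] (i j p : ℤ) : Set where
  constructor _,_
  field
    multiple : ℤ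
    equality : j ≡ i + multiple * p

-- The part of the geometry of V that the argument uses: p is N, and E i and D are the coordinates of ẽ_i and δ.
record Frame : Set₁ where
  field
    p   : ℤ
    p>0 : + 0 < p
    K   : Set
    E   : ℤ → K → ℤ
    D   : K → ℤ
    κ₀  : K
    D-κ₀ : D κ₀ ≡ + 1
    E-shift : ∀ i d κ → E (i + d * p) κ ≡ E i κ + d * D κ
    E-neg   : ∀ i κ → E (- i) κ ≡ - E i κ

  infix 4 _≈_
  _≈_ : ℤ → ℤ → Set
  i ≈ j = i ≡ j [mod p ]

  NZ : ℤ → Set
  NZ i = ¬ (+ 0 ≈ i)

  field
    coordinate : ∀ x → NZ x → ∃[ κ ] ∃[ σ ] D κ ≡ + 0 × σ * E x κ ≡ + 1 ×
      (∀ y → (σ * E y κ ≡ + 1 × x ≈ y) ⊎ (σ * E y κ ≡ - + 1 × - x ≈ y) ⊎ (σ * E y κ ≡ + 0))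
    _≈?_ : ∀ i j → (i ≈ j) ⊎ ¬ (i ≈ j)

-- Coordinates of integer vectors.

lookup-ext : ∀ {m} {u v : Vec ℤ m} → (∀ κ → lookup u κ ≡ lookup v κ) → u ≡ v
lookup-ext {u = []}    {[]}    h = refl
lookup-ext {u = _ ∷ _} {_ ∷ _} h = cong₂ _∷_ (h Fin.zero) (lookup-ext (h ∘ Fin.suc))

module _ {n : ℕ} where

  lookup-⊕ : ∀ (u v : V n) κ → lookup (u ⊕ v) κ ≡ lookup u κ + lookup v κ
  lookup-⊕ u v κ = lookup-zipWith _ κ u v

  lookup-⊝ : ∀ (u v : V n) κ → lookup (u ⊝ v) κ ≡ lookup u κ + - lookup v κ
  lookup-⊝ u v κ = lookup-zipWith _ κ u v

  lookup-· : ∀ c (v : V n) κ → lookup (c · v) κ ≡ c * lookup v κ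
  lookup-· c v κ = lookup-map κ (c *_) v

  lookup-unit : ∀ (k j : Fin (suc n)) → lookup (unit k) j ≡ (if ⌊ k Fin.≟ j ⌋ then + 1 else + 0)
  lookup-unit k j = lookup∘tabulate (λ j → if ⌊ k Fin.≟ j ⌋ then + 1 else + 0) j

  lookup-unit-≡ : ∀ {k j : Fin (suc n)} → k ≡ j → lookup (unit k) j ≡ + 1
  lookup-unit-≡ {k} {j} eq with k Fin.≟ j | lookup-unit k j
  ... | yes _ | h = h
  ... | no ne | h = contradiction eq ne

  lookup-unit-≢ : ∀ {k j : Fin (suc n)} → k ≢ j → lookup (unit k) j ≡ + 0
  lookup-unit-≢ {k} {j} ne with k Fin.≟ j | lookup-unit k j
  ... | yes eq | h = contradiction eq ne
  ... | no _ | h = h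

-- Uniqueness of division with remainder.

quotient-≮ : ∀ {M r r′ : ℕ} {q q′ : ℤ} → r ℕ.< M → + r + q * + M ≡ + r′ + q′ * + M → ¬ (q < q′)
quotient-≮ {M} {r} {r′} {q} {q′} r<M eq q<q′ = <-irrefl eq (begin-strict
  + r + q * + M        <⟨ +-monoˡ-< (q * + M) (+<+ r<M) ⟩
  + M + q * + M        ≡⟨ sym (suc-* q (+ M)) ⟩
  sucℤ q * + M         ≤⟨ *-monoʳ-≤-nonNeg (+ M) (i<j⇒suc[i]≤j q<q′) ⟩
  q′ * + M             ≤⟨ i≤j+i (q′ * + M) (+ r′) ⟩
  + r′ + q′ * + M      ∎)
  where open ≤-Reasoning
        sucℤ = Data.Integer.suc

divMod-unique : ∀ {M r r′ : ℕ} {q q′ : ℤ} → r ℕ.< M → r′ ℕ.< M →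
                + r + q * + M ≡ + r′ + q′ * + M → q ≡ q′ × r ≡ r′
divMod-unique {M} {q = q} {q′} r<M r′<M eq with <-cmp q q′
... | tri< q<q′ _ _ = contradiction q<q′ (quotient-≮ r<M eq)
... | tri> _ _ q>q′ = contradiction q>q′ (quotient-≮ r′<M (sym eq))
... | tri≈ _ refl _ = refl , +-injective (+-cancelʳ (q * + M) _ _ eq)

-- The vectors ẽ_i in coordinates.

module AffineC (n : ℕ) where

  private
    p : ℤ
    p = + N n

    E : ℤ → Fin (suc n) → ℤ
    E i κ = lookup (e n i) κ

    D : Fin (suc n) → ℤ
    D κ = lookup (δ {n}) κ

    S : ℕ → Fin (suc n) → ℤ
    S k κ = lookup (small n k) κ

  e-quotRem : ∀ {r} q → r ℕ.< N n → e n (+ r + q * p) ≡ (q · δ) ⊕ ebar n r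
  e-quotRem {r} q r<N = cong₂ (λ a b → (a · δ) ⊕ ebar n b) (proj₁ h) (proj₂ h)
    where
    i = + r + q * p
    h : i /ℕ N n ≡ q × i %ℕ N n ≡ r
    h = divMod-unique (n%ℕd<d i (N n)) r<N (sym (a≡a%ℕn+[a/ℕn]*n i (N n)))

  ebar-≤ : ∀ {k} → k ℕ.≤ n → ebar n k ≡ small n k
  ebar-≤ {k} k≤n with k ℕ.≤? n
  ... | yes _ = refl
  ... | no k≰n = contradiction k≤n k≰n

  ebar-> : ∀ {k} → n ℕ.< k → ebar n k ≡ δ ⊝ small n (N n ℕ.∸ k)
  ebar-> {k} n<k with k ℕ.≤? n
  ... | yes k≤n = contradiction n<k (ℕ.≤⇒≯ k≤n)
  ... | no _ = refl

  ≤⇒<N : ∀ {k} → k ℕ.≤ n → k ℕ.< N n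
  ≤⇒<N k≤n = ℕ.s≤s (ℕ.≤-trans k≤n (ℕ.m≤m+n n n))

  E-pos : ∀ d {k} → k ℕ.≤ n → ∀ κ → E (d * p + + 1 * + k) κ ≡ d * D κ + + 1 * S k κ
  E-pos d {k} k≤n κ = begin
    E (d * p + + 1 * + k) κ          ≡⟨ cong (λ i → E i κ) (h₁ d p (+ k)) ⟩
    E (+ k + d * p) κ                ≡⟨ cong (λ v → lookup v κ) (e-quotRem d (≤⇒<N k≤n)) ⟩
    lookup ((d · δ) ⊕ ebar n k) κ    ≡⟨ lookup-⊕ (d · δ) (ebar n k) κ ⟩
    lookup (d · δ) κ + lookup (ebar n k) κ
      ≡⟨ cong₂ _+_ (lookup-· d δ κ) (trans (cong (λ v → lookup v κ) (ebar-≤ k≤n)) (sym (*-identityˡ _))) ⟩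
    d * D κ + + 1 * S k κ            ∎
    where
    open ≡-Reasoning
    h₁ : ∀ d p k → d * p + + 1 * k ≡ k + d * p
    h₁ = solve-∀

  -- For k ≥ 1 the integer dN - k has quotient d - 1 and remainder N - k > n, so `ebar` takes its
  -- reflected branch δ - ẽ_k, and this δ makes up for the lowered quotient.
  E-negsuc : ∀ d {k} → suc k ℕ.≤ n → ∀ κ → E (d * p + - + 1 * + suc k) κ ≡ d * D κ + - + 1 * S (suc k) κ
  E-negsuc d {k} sk≤n κ = begin
    E (d * p + - + 1 * + suc k) κ        ≡⟨ cong (λ i → E i κ) i≡ ⟩
    E (+ r + (d - + 1) * p) κ            ≡⟨ cong (λ v → lookup v κ) (e-quotRem (d - + 1) r<N) ⟩
    lookup (((d - + 1) · δ) ⊕ ebar n r) κ  ≡⟨ lookup-⊕ ((d - + 1) · δ) (ebar n r) κ ⟩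
    lookup ((d - + 1) · δ) κ + lookup (ebar n r) κ
      ≡⟨ cong₂ _+_ (lookup-· (d - + 1) δ κ) (cong (λ v → lookup v κ) ebar≡) ⟩
    (d - + 1) * D κ + lookup (δ ⊝ small n (suc k)) κ  ≡⟨ cong (_+_ ((d - + 1) * D κ)) (lookup-⊝ δ (small n (suc k)) κ) ⟩
    (d - + 1) * D κ + (D κ + - S (suc k) κ)  ≡⟨ h₂ d (D κ) (S (suc k) κ) ⟩
    d * D κ + - + 1 * S (suc k) κ        ∎
    where
    open ≡-Reasoning
    r = N n ℕ.∸ suc k
    sk≤N : suc k ℕ.≤ N n
    sk≤N = ℕ.<⇒≤ (≤⇒<N sk≤n)
    r+sk : r ℕ.+ suc k ≡ N n
    r+sk = ℕ.m∸n+n≡m sk≤N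
    r<N : r ℕ.< N n
    r<N = ℕ.∸-monoʳ-< {N n} {suc k} {0} (ℕ.s≤s ℕ.z≤n) sk≤N
    n<r : n ℕ.< r
    n<r = ℕ.m+n≤o⇒m≤o∸n (suc n) (ℕ.s≤s (ℕ.+-monoʳ-≤ n sk≤n))
    h₁ : ∀ d r s → d * (r + s) + - + 1 * s ≡ r + (d - + 1) * (r + s)
    h₁ = solve-∀
    h₂ : ∀ d D s → (d - + 1) * D + (D + - s) ≡ d * D + - + 1 * s
    h₂ = solve-∀
    i≡ : d * p + - + 1 * + suc k ≡ + r + (d - + 1) * p
    i≡ = subst (λ q → d * q + - + 1 * + suc k ≡ + r + (d - + 1) * q)
               (trans (sym (pos-+ r (suc k))) (cong +_ r+sk)) (h₁ d (+ r) (+ suc k))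
    ebar≡ : ebar n r ≡ δ ⊝ small n (suc k)
    ebar≡ = trans (ebar-> n<r) (cong (λ j → δ ⊝ small n j) (ℕ.m∸[m∸n]≡n sk≤N))

  IsSign : ℤ → Set
  IsSign σ = σ ≡ + 1 ⊎ σ ≡ - + 1

  E-signed : ∀ d {k σ} → k ℕ.≤ n → IsSign σ → ∀ κ → E (d * p + σ * + k) κ ≡ d * D κ + σ * S k κ
  E-signed d k≤n (inj₁ refl) κ = E-pos d k≤n κ
  E-signed d {suc k} k≤n (inj₂ refl) κ = E-negsuc d k≤n κ
  E-signed d {zero} k≤n (inj₂ refl) κ = trans (E-pos d k≤n κ)
    (cong (_+_ (d * D κ)) (trans (cong (+ 1 *_) (lookup-replicate κ (+ 0)))
                              (sym (cong (- + 1 *_) (lookup-replicate κ (+ 0))))))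

  -- Balanced residues. In this form a translation changes only `d` and a negation flips `d` and
  -- `σ`, which turns `E-shift` and `E-neg` into ring identities.
  signedForm : ∀ i → ∃[ d ] ∃[ k ] ∃[ σ ] k ℕ.≤ n × IsSign σ × i ≡ d * p + σ * + k
  signedForm i with (i %ℕ N n) ℕ.≤? n
  ... | yes r≤n = i /ℕ N n , i %ℕ N n , + 1 , r≤n , inj₁ refl ,
        trans (a≡a%ℕn+[a/ℕn]*n i (N n)) (h (i /ℕ N n) p (+ (i %ℕ N n)))
    where
    h : ∀ d p k → k + d * p ≡ d * p + + 1 * k
    h = solve-∀
  -- A remainder r > n is counted back from the next multiple of N; N = 2n + 1 gives N - r ≤ n.
  ... | no r≰n = i /ℕ N n + + 1 , k , - + 1 , k≤n , inj₂ refl ,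
        trans (a≡a%ℕn+[a/ℕn]*n i (N n))
              (subst (λ q → + r + (i /ℕ N n) * q ≡ (i /ℕ N n + + 1) * q + - + 1 * + k)
                     (trans (sym (pos-+ r k)) (cong +_ (ℕ.m+[n∸m]≡n (ℕ.<⇒≤ (n%ℕd<d i (N n))))))
                         (h (i /ℕ N n) (+ r) (+ k)))
    where
    r = i %ℕ N n
    k = N n ℕ.∸ r
    k≤n : k ℕ.≤ n
    k≤n = ℕ.≤-trans (ℕ.∸-monoʳ-≤ (N n) (ℕ.≰⇒> r≰n)) (ℕ.≤-reflexive (ℕ.m+n∸m≡n n n))
    h : ∀ d r k → r + d * (r + k) ≡ (d + + 1) * (r + k) + - + 1 * k
    h = solve-∀

  E-shift : ∀ i d κ → E (i + d * p) κ ≡ E i κ + d * D κ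
  E-shift i d κ with signedForm i
  ... | c , k , σ , k≤n , sσ , refl = begin
    E (c * p + σ * + k + d * p) κ    ≡⟨ cong (λ i → E i κ) (h c d σ p (+ k)) ⟩
    E ((c + d) * p + σ * + k) κ      ≡⟨ E-signed (c + d) k≤n sσ κ ⟩
    (c + d) * D κ + σ * S k κ        ≡⟨ sym (h c d σ (D κ) (S k κ)) ⟩
    c * D κ + σ * S k κ + d * D κ    ≡⟨ cong (_+ d * D κ) (sym (E-signed c k≤n sσ κ)) ⟩
    E (c * p + σ * + k) κ + d * D κ  ∎
    where
    open ≡-Reasoning
    h : ∀ c d σ p k → c * p + σ * k + d * p ≡ (c + d) * p + σ * k
    h = solve-∀

  neg-sign : ∀ {σ} → IsSign σ → IsSign (- σ)
  neg-sign (inj₁ refl) = inj₂ refl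
  neg-sign (inj₂ refl) = inj₁ refl

  E-neg : ∀ i κ → E (- i) κ ≡ - E i κ
  E-neg i κ with signedForm i
  ... | c , k , σ , k≤n , sσ , refl = begin
    E (- (c * p + σ * + k)) κ        ≡⟨ cong (λ i → E i κ) (h c σ p (+ k)) ⟩
    E ((- c) * p + (- σ) * + k) κ    ≡⟨ E-signed (- c) k≤n (neg-sign sσ) κ ⟩
    (- c) * D κ + (- σ) * S k κ      ≡⟨ sym (h c σ (D κ) (S k κ)) ⟩
    - (c * D κ + σ * S k κ)          ≡⟨ cong -_ (sym (E-signed c k≤n sσ κ)) ⟩
    - E (c * p + σ * + k) κ          ∎
    where
    open ≡-Reasoning
    h : ∀ c σ p k → - (c * p + σ * k) ≡ (- c) * p + (- σ) * k
    h = solve-∀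

  infix 4 _≈_ _≈?_
  _≈_ : ℤ → ℤ → Set
  i ≈ j = i ≡ j [mod p ]

  index : ∀ {k} → suc k ℕ.≤ n → Fin (suc n)
  index sk≤n = Fin.fromℕ< (ℕ.s≤s sk≤n)

  small-index : ∀ {k} (sk≤n : suc k ℕ.≤ n) → small n (suc k) ≡ unit (index sk≤n)
  small-index {k} sk≤n with suc k ℕ.<? suc n
  ... | yes q = cong unit (Fin.fromℕ<-cong (suc k) (suc k) refl q (ℕ.s≤s sk≤n))
  ... | no ¬q = contradiction (ℕ.s≤s sk≤n) ¬q

  S-index : ∀ {k} (sk≤n : suc k ℕ.≤ n) → S (suc k) (index sk≤n) ≡ + 1
  S-index sk≤n = trans (cong (λ v → lookup v (index sk≤n)) (small-index sk≤n))
    (lookup-unit-≡ {k = index sk≤n} refl)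

  S-index-≢ : ∀ {k} (sk≤n : suc k ℕ.≤ n) {l} → l ℕ.≤ n → l ≢ suc k → S l (index sk≤n) ≡ + 0
  S-index-≢ sk≤n {zero} _ _ = lookup-replicate (index sk≤n) (+ 0)
  S-index-≢ sk≤n {suc l} sl≤n ne = trans (cong (λ v → lookup v (index sk≤n)) (small-index sl≤n))
    (lookup-unit-≢ {k = index sl≤n} (λ eq → ne (Fin.fromℕ<-injective _ _ (ℕ.s≤s sl≤n) (ℕ.s≤s sk≤n) eq)))

  D-index : ∀ {k} (sk≤n : suc k ℕ.≤ n) → D (index sk≤n) ≡ + 0
  D-index {k} sk≤n = lookup-unit-≢ {n} {Fin.zero} {index sk≤n} (λ ())

  -- Write x as dN ± k in balanced form, with k ≥ 1 because x is not divisible by N. The coordinate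
  -- of ẽ_k and the sign of x serve: δ vanishes there, and so does every ẽ_y unless y has the same k
  -- in its balanced form, when y ≡ x or y ≡ -x according to its sign.
  coordinate : ∀ x → ¬ (+ 0 ≈ x) → ∃[ κ ] ∃[ σ ] D κ ≡ + 0 × σ * E x κ ≡ + 1 ×
      (∀ y → (σ * E y κ ≡ + 1 × x ≈ y) ⊎ (σ * E y κ ≡ - + 1 × - x ≈ y) ⊎ (σ * E y κ ≡ + 0))
  coordinate x x≉0 with signedForm x
  ... | c , zero , σ , _ , _ , refl = contradiction (c , h c p σ) x≉0
    where
    h : ∀ c p σ → c * p + σ * + 0 ≡ + 0 + c * p
    h = solve-∀
  ... | c , suc k , σ , k≤n , sσ , refl =
      κ , σ , D-index k≤n , trans (value (c , k≤n , sσ , refl))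
          (trans (cong (λ s → σ * (σ * s)) (S-index k≤n)) (σσ sσ)) , tri
    where
    κ = index k≤n
    value : ∀ {y l τ} → ∃[ d ] (l ℕ.≤ n × IsSign τ × y ≡ d * p + τ * + l) → σ * E y κ ≡ σ * (τ * S l κ)
    value {l = l} {τ} (d , l≤n , sτ , refl) = cong (σ *_) (trans (E-signed d l≤n sτ κ)
      (trans (cong (λ z → d * z + τ * S l κ) (D-index k≤n)) (h d (τ * S l κ))))
      where
      h : ∀ d z → d * + 0 + z ≡ z
      h = solve-∀
    σσ : ∀ {σ} → IsSign σ → σ * (σ * + 1) ≡ + 1
    σσ (inj₁ refl) = refl
    σσ (inj₂ refl) = refl
    same : ∀ c d σ p k → d * p + σ * k ≡ c * p + σ * k + (d - c) * p
    same = solve-∀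
    opp : ∀ c d σ p k → d * p + (- σ) * k ≡ - (c * p + σ * k) + (d + c) * p
    opp = solve-∀
    match : ∀ {τ} → IsSign σ → IsSign τ → (τ ≡ σ × σ * (τ * + 1) ≡ + 1) ⊎ (τ ≡ - σ × σ * (τ * + 1) ≡ - + 1)
    match (inj₁ refl) (inj₁ refl) = inj₁ (refl , refl)
    match (inj₁ refl) (inj₂ refl) = inj₂ (refl , refl)
    match (inj₂ refl) (inj₁ refl) = inj₂ (refl , refl)
    match (inj₂ refl) (inj₂ refl) = inj₁ (refl , refl)
    tri : ∀ y → (σ * E y κ ≡ + 1 × (c * p + σ * + suc k) ≈ y) ⊎ (σ * E y κ ≡ - + 1 × (- (c * p + σ * + suc k)) ≈ y)
        ⊎ (σ * E y κ ≡ + 0)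
    tri y with signedForm y
    ... | d , l , τ , l≤n , sτ , y≡ with l ℕ.≟ suc k
    ... | no l≢k = inj₂ (inj₂ (trans (value (d , l≤n , sτ , y≡))
            (trans (cong (λ z → σ * (τ * z)) (S-index-≢ k≤n l≤n l≢k)) (h σ τ))))
      where
      h : ∀ σ τ → σ * (τ * + 0) ≡ + 0
      h = solve-∀
    ... | yes refl with match sσ sτ | trans (value (d , l≤n , sτ , y≡)) (cong (λ z → σ * (τ * z)) (S-index k≤n))
    ... | inj₁ (refl , v) | w = inj₁ (trans w v , d - c , trans y≡ (same c d σ p (+ suc k)))
    ... | inj₂ (refl , v) | w = inj₂ (inj₁ (trans w v , d + c , trans y≡ (opp c d σ p (+ suc k))))

  ≈⇒∣ : ∀ {i j} → i ≈ j → p Unsigned.∣ (j + - i)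
  ≈⇒∣ {i} {j} (d , eq) = ∣⇒∣ᵤ {p} {j + - i} (divides d (trans (cong (_+ - i) eq) (h i d p)))
    where
    h : ∀ i d p → i + d * p + - i ≡ d * p
    h = solve-∀

  ∣⇒≈ : ∀ {i j} → p Unsigned.∣ (j + - i) → i ≈ j
  ∣⇒≈ {i} {j} h with ∣ᵤ⇒∣ {p} {j + - i} h
  ... | divides d eq = d , trans (g i j) (cong (_+_ i) eq)
    where
    g : ∀ i j → j ≡ i + (j + - i)
    g = solve-∀

  _≈?_ : ∀ i j → (i ≈ j) ⊎ ¬ (i ≈ j)
  i ≈? j with p ∣? (j + - i)
  ... | yes h = inj₁ (∣⇒≈ (∣⇒∣ᵤ h))
  ... | no h = inj₂ (h ∘ ∣ᵤ⇒∣ ∘ ≈⇒∣)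

  frame : Frame
  frame = record
    { p = p ; p>0 = +<+ (ℕ.s≤s ℕ.z≤n) ; K = Fin (suc n) ; E = E ; D = D ; κ₀ = Fin.zero ; D-κ₀ = refl
    ; E-shift = E-shift ; E-neg = E-neg ; coordinate = coordinate ; _≈?_ = _≈?_ }

-- Congruence arithmetic and the differences ẽ_x - ẽ_y.

module Congruence (F : Frame) where
  open Frame F

  ≈-refl : ∀ {i} → i ≈ i
  ≈-refl {i} = + 0 , h i p
    where
    h : ∀ i p → i ≡ i + + 0 * p
    h = solve-∀

  ≈-sym : ∀ {i j} → i ≈ j → j ≈ i
  ≈-sym {i} (d , refl) = - d , h i d p
    where
    h : ∀ i d p → i ≡ i + d * p + - d * p
    h = solve-∀

  ≈-trans : ∀ {i j k} → i ≈ j → j ≈ k → i ≈ k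
  ≈-trans {i} (d , refl) (c , refl) = d + c , h i d c p
    where
    h : ∀ i d c p → i + d * p + c * p ≡ i + (d + c) * p
    h = solve-∀

  ≈-neg : ∀ {i j} → i ≈ j → - i ≈ - j
  ≈-neg {i} (d , refl) = - d , h i d p
    where
    h : ∀ i d p → - (i + d * p) ≡ - i + - d * p
    h = solve-∀

  ≈-shift : ∀ i d → i ≈ i + d * p
  ≈-shift i d = d , refl

  ≉-shift : ∀ {i j} d → ¬ i ≈ j → ¬ (i + d * p) ≈ (j + d * p)
  ≉-shift d i≉j h = i≉j (≈-trans (≈-shift _ d) (≈-trans h (≈-sym (≈-shift _ d))))

  ≉-sym : ∀ {i j} → ¬ i ≈ j → ¬ j ≈ i
  ≉-sym i≉j = i≉j ∘ ≈-sym

  ≈-neg⁻¹ : ∀ {i j} → - i ≈ - j → i ≈ j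
  ≈-neg⁻¹ {i} {j} h = subst₂ _≈_ (neg-involutive i) (neg-involutive j) (≈-neg h)

  ≉-neg : ∀ {i j} → ¬ i ≈ j → ¬ - j ≈ - i
  ≉-neg i≉j = i≉j ∘ ≈-sym ∘ ≈-neg⁻¹

  NZ-resp : ∀ {i j} → i ≈ j → NZ i → NZ j
  NZ-resp i≈j nz 0≈j = nz (≈-trans 0≈j (≈-sym i≈j))

  NZ-neg : ∀ {i} → NZ i → NZ (- i)
  NZ-neg nz h = nz (≈-neg⁻¹ h)

  shift-cancel : ∀ i d → i + d * p + - d * p ≡ i
  shift-cancel i d = h i d p
    where
    h : ∀ i d p → i + d * p + - d * p ≡ i
    h = solve-∀

  Δ : ℤ → ℤ → K → ℤ
  Δ x y κ = E x κ - E y κ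

  Δ-add : ∀ x y z κ → Δ x y κ + Δ y z κ ≡ Δ x z κ
  Δ-add x y z κ = h (E x κ) (E y κ) (E z κ)
    where
    h : ∀ x y z → (x - y) + (y - z) ≡ x - z
    h = solve-∀

  Δ-δ : ∀ x d κ → Δ (x + d * p) x κ ≡ d * D κ
  Δ-δ x d κ = trans (cong (_- E x κ) (E-shift x d κ)) (h (E x κ) (d * D κ))
    where
    h : ∀ x y → x + y - x ≡ y
    h = solve-∀

  Δ-shift : ∀ x y d κ → Δ (x + d * p) (y + d * p) κ ≡ Δ x y κ
  Δ-shift x y d κ = trans (cong₂ _-_ (E-shift x d κ) (E-shift y d κ)) (h (E x κ) (E y κ) (d * D κ))
    where
    h : ∀ x y z → (x + z) - (y + z) ≡ x - y
    h = solve-∀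

  Δ-neg : ∀ x y κ → Δ (- y) (- x) κ ≡ Δ x y κ
  Δ-neg x y κ = trans (cong₂ _-_ (E-neg y κ) (E-neg x κ)) (h (E x κ) (E y κ))
    where
    h : ∀ x y → - y - - x ≡ x - y
    h = solve-∀

-- Orders invariant under translation and negation.

record InvariantOrder (F : Frame) : Set₁ where
  open Frame F
  infix 4 _≻_
  field
    _≻_      : ℤ → ℤ → Set
    ≻-nzˡ    : ∀ {i j} → i ≻ j → NZ i
    ≻-nzʳ    : ∀ {i j} → i ≻ j → NZ j
    ≻-trans  : ∀ {i j k} → i ≻ j → j ≻ k → i ≻ k
    ≻-irrefl : ∀ {i} → ¬ i ≻ i
    ≻-shift  : ∀ {i j} d → i ≻ j → i + d * p ≻ j + d * p
    ≻-neg    : ∀ {i j} → i ≻ j → - j ≻ - i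

-- Coefficients are stored as predecessors. When `ℕ.compare` presents the larger index as
-- `suc (a + k)`, the larger coefficient is the smaller one plus the positive remainder `suc k`.
split : ∀ a k → + suc (suc (a ℕ.+ k)) ≡ + suc a + + suc k
split a k = cong (+_ ∘ suc) (sym (ℕ.+-suc a k))

nonneg-* : ∀ a {y} → + 0 ≤ y → + 0 ≤ + suc a * y
nonneg-* a {y} 0≤y = ≤-trans (≤-reflexive (sym (*-zeroʳ (+ suc a)))) (*-monoˡ-≤-nonNeg (+ suc a) 0≤y)

positive-sum : ∀ a {x y} → + 1 ≤ x → + 0 ≤ y → ¬ + suc a * x + y ≡ + 0
positive-sum a {x} {y} 1≤x 0≤y eq = <-irrefl (sym eq) (begin-strict
  + 0                <⟨ +<+ (ℕ.s≤s ℕ.z≤n) ⟩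
  + suc a            ≡⟨ sym (*-identityʳ (+ suc a)) ⟩
  + suc a * + 1      ≤⟨ *-monoˡ-≤-nonNeg (+ suc a) 1≤x ⟩
  + suc a * x        ≡⟨ sym (+-identityʳ _) ⟩
  + suc a * x + + 0  ≤⟨ +-monoʳ-≤ (+ suc a * x) 0≤y ⟩
  + suc a * x + y    ∎)
  where open ≤-Reasoning

-- Linear relations read in a single coordinate.

module Relations (F : Frame) where
  open Frame F
  open Congruence F

  Rel₁ : (A x y m : ℤ) → Set
  Rel₁ A x y m = ∀ κ → A * Δ x y κ + m * D κ ≡ + 0

  Rel₂ : (A x y B z w m : ℤ) → Set
  Rel₂ A x y B z w m = ∀ κ → A * Δ x y κ + B * Δ z w κ + m * D κ ≡ + 0

  Rel₃ : (A x y B z w C u v : ℤ) → Set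
  Rel₃ A x y B z w C u v = ∀ κ → A * Δ x y κ + B * Δ z w κ + C * Δ u v κ ≡ + 0

  Value : (σ : ℤ) (κ : K) (x y : ℤ) → Set
  Value σ κ x y = (σ * E y κ ≡ + 1 × x ≈ y) ⊎ (σ * E y κ ≡ - + 1 × - x ≈ y) ⊎ (σ * E y κ ≡ + 0)

  -- The two ways in which ẽ_z - ẽ_w can acquire a negative coefficient at ẽ_x.
  Cancels : ℤ → ℤ → ℤ → Set
  Cancels x z w = x ≈ w ⊎ - x ≈ z

  σΔ : ∀ σ κ z w {a b} → σ * E z κ ≡ a → σ * E w κ ≡ b → σ * Δ z w κ ≡ a - b
  σΔ σ κ z w refl refl = h σ (E z κ) (E w κ)
    where
    h : ∀ σ z w → σ * (z - w) ≡ σ * z - σ * w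
    h = solve-∀

  cancels? : ∀ σ κ {x} z w → Value σ κ x z → Value σ κ x w → Cancels x z w ⊎ + 0 ≤ σ * Δ z w κ
  cancels? σ κ z w (inj₂ (inj₁ (_ , h))) _ = inj₁ (inj₂ h)
  cancels? σ κ z w (inj₁ _) (inj₁ (_ , h)) = inj₁ (inj₁ h)
  cancels? σ κ z w (inj₂ (inj₂ _)) (inj₁ (_ , h)) = inj₁ (inj₁ h)
  cancels? σ κ z w (inj₁ (e , _)) (inj₂ (inj₁ (f , _))) = inj₂
      (≤-trans (+≤+ ℕ.z≤n) (≤-reflexive (sym (σΔ σ κ z w e f))))
  cancels? σ κ z w (inj₁ (e , _)) (inj₂ (inj₂ f)) = inj₂ (≤-trans (+≤+ ℕ.z≤n) (≤-reflexive (sym (σΔ σ κ z w e f))))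
  cancels? σ κ z w (inj₂ (inj₂ e)) (inj₂ (inj₁ (f , _))) = inj₂
      (≤-trans (+≤+ ℕ.z≤n) (≤-reflexive (sym (σΔ σ κ z w e f))))
  cancels? σ κ z w (inj₂ (inj₂ e)) (inj₂ (inj₂ f)) = inj₂ (≤-reflexive (sym (σΔ σ κ z w e f)))

  leading : ∀ σ κ x y → ¬ x ≈ y → σ * E x κ ≡ + 1 → Value σ κ x y → + 1 ≤ σ * Δ x y κ
  leading σ κ x y x≉y e (inj₁ (_ , h)) = contradiction h x≉y
  leading σ κ x y x≉y e (inj₂ (inj₁ (f , _))) = ≤-trans (+≤+ (ℕ.s≤s ℕ.z≤n)) (≤-reflexive (sym (σΔ σ κ x y e f)))
  leading σ κ x y x≉y e (inj₂ (inj₂ f)) = ≤-reflexive (sym (σΔ σ κ x y e f))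

  -- In the coordinate belonging to x, taken with its sign, δ vanishes and ẽ_x - ẽ_y is at least 1,
  -- so the sum cannot be 0. `Rel₂-cancels` and `Rel₃-cancels` read their relations in the same
  -- coordinate and conclude that another term is negative there.
  no-Rel₁ : ∀ a {x y} m → NZ x → ¬ x ≈ y → ¬ Rel₁ (+ suc a) x y m
  no-Rel₁ a {x} {y} m nz x≉y rel with coordinate x nz
  ... | κ , σ , D0 , e , val = positive-sum a (leading σ κ x y x≉y e (val y)) ≤-refl (begin
      + suc a * (σ * Δ x y κ) + + 0              ≡⟨ h σ (+ suc a) (Δ x y κ) m ⟩
      σ * (+ suc a * Δ x y κ + m * + 0)          ≡⟨ cong (λ z → σ * (+ suc a * Δ x y κ + m * z)) (sym D0) ⟩
      σ * (+ suc a * Δ x y κ + m * D κ)          ≡⟨ cong (σ *_) (rel κ) ⟩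
      σ * + 0                                    ≡⟨ *-zeroʳ σ ⟩
      + 0                                        ∎)
    where
    open ≡-Reasoning
    h : ∀ σ A X m → A * (σ * X) + + 0 ≡ σ * (A * X + m * + 0)
    h = solve-∀

  Rel₂-cancels : ∀ a b {x y z w} m → NZ x → ¬ x ≈ y → Rel₂ (+ suc a) x y (+ suc b) z w m → Cancels x z w
  Rel₂-cancels a b {x} {y} {z} {w} m nz x≉y rel with coordinate x nz
  ... | κ , σ , D0 , e , val with cancels? σ κ z w (val z) (val w)
  ... | inj₁ c = c
  ... | inj₂ le = contradiction (begin
      + suc a * (σ * Δ x y κ) + + suc b * (σ * Δ z w κ)              ≡⟨ h σ (+ suc a) (Δ x y κ) (+ suc b) (Δ z w κ) m ⟩
      σ * (+ suc a * Δ x y κ + + suc b * Δ z w κ + m * + 0)          ≡⟨ cong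
          (λ d → σ * (+ suc a * Δ x y κ + + suc b * Δ z w κ + m * d)) (sym D0) ⟩
      σ * (+ suc a * Δ x y κ + + suc b * Δ z w κ + m * D κ)          ≡⟨ cong (σ *_) (rel κ) ⟩
      σ * + 0                                    ≡⟨ *-zeroʳ σ ⟩
      + 0                                        ∎) (positive-sum a (leading σ κ x y x≉y e (val y)) (nonneg-* b le))
    where
    open ≡-Reasoning
    h : ∀ σ A X B Y m → A * (σ * X) + B * (σ * Y) ≡ σ * (A * X + B * Y + m * + 0)
    h = solve-∀

  Rel₃-cancels : ∀ a b c {x y z w u v} → NZ x → ¬ x ≈ y → Rel₃ (+ suc a) x y (+ suc b) z w (+ suc c) u v →
                 Cancels x z w ⊎ Cancels x u v
  Rel₃-cancels a b c {x} {y} {z} {w} {u} {v} nz x≉y rel with coordinate x nz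
  ... | κ , σ , D0 , e , val with cancels? σ κ z w (val z) (val w) | cancels? σ κ u v (val u) (val v)
  ... | inj₁ c | _ = inj₁ c
  ... | inj₂ _ | inj₁ c = inj₂ c
  ... | inj₂ le | inj₂ le′ = contradiction (begin
      + suc a * (σ * X) + (+ suc b * (σ * Y) + + suc c * (σ * Z))    ≡⟨ h σ (+ suc a) X (+ suc b) Y (+ suc c) Z ⟩
      σ * (+ suc a * X + + suc b * Y + + suc c * Z)          ≡⟨ cong (σ *_) (rel κ) ⟩
      σ * + 0                                    ≡⟨ *-zeroʳ σ ⟩
      + 0                                        ∎)
        (positive-sum a (leading σ κ x y x≉y e (val y)) (+-mono-≤ (nonneg-* b le) (nonneg-* c le′)))
    where
    open ≡-Reasoning
    X = Δ x y κ
    Y = Δ z w κ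
    Z = Δ u v κ
    h : ∀ σ A X B Y C Z → A * (σ * X) + (B * (σ * Y) + C * (σ * Z)) ≡ σ * (A * X + B * Y + C * Z)
    h = solve-∀

-- Euclidean descent on vanishing positive combinations.

module NoRelation {F : Frame} (O : InvariantOrder F) where
  open Frame F
  open Congruence F
  open Relations F
  open InvariantOrder O

  iterate : ∀ x d → x + d * p ≻ x → ∀ k → x + (+ suc k * d) * p ≻ x
  iterate x d h zero = subst (λ c → x + c * p ≻ x) (sym (*-identityˡ d)) h
  iterate x d h (suc k) = subst (_≻ x) (g x (+ suc k) d p) (≻-trans (≻-shift d (iterate x d h k)) h)
    where
    g : ∀ x k d p → x + (k * d) * p + d * p ≡ x + ((+ 1 + k) * d) * p
    g = solve-∀

  -- Rewrites the cancelling root, without changing its vector, so that it ends exactly at `x`: a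
  -- translation if w ≡ x, a negation followed by a translation if z ≡ -x.
  align : ∀ {x z w} → Cancels x z w → z ≻ w → ¬ z ≈ w →
          ∃[ z′ ] z′ ≻ x × ¬ z′ ≈ x × (∀ κ → Δ z′ x κ ≡ Δ z w κ)
  align {x} {z} {w} (inj₁ (d , refl)) z≻w z≉w =
    z + - d * p , subst (z + - d * p ≻_) (shift-cancel x d) (≻-shift (- d) z≻w) ,
    subst (λ v → ¬ (z + - d * p) ≈ v) (shift-cancel x d) (≉-shift (- d) z≉w) ,
    λ κ → trans (cong (λ v → Δ (z + - d * p) v κ) (sym (shift-cancel x d))) (Δ-shift z w (- d) κ)
  align {x} {z} {w} (inj₂ (d , refl)) z≻w z≉w =
    - w + d * p , subst (- w + d * p ≻_) (h x d p) (≻-shift d (≻-neg z≻w)) ,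
    subst (λ v → ¬ (- w + d * p) ≈ v) (h x d p) (≉-shift d (≉-neg z≉w)) ,
    λ κ → trans (cong (λ v → Δ (- w + d * p) v κ) (sym (h x d p))) (trans (Δ-shift (- w) (- z) d κ) (Δ-neg z w κ))
    where
    h : ∀ x d p → - (- x + d * p) + d * p ≡ x
    h = solve-∀

  -- Negation reverses both the order and the direction of the translation, so the condition on `m`
  -- passes from x to -x.
  ¬-≻-neg : ∀ {x} m → ¬ x ≻ x + m * p → ¬ - x ≻ - x + m * p
  ¬-≻-neg {x} m h g = h (subst₂ _≻_ (h₁ x m p) (h₂ x m p) (≻-shift m (≻-neg g)))
    where
    h₁ : ∀ x m p → - (- x + m * p) + m * p ≡ x
    h₁ = solve-∀
    h₂ : ∀ x m p → - - x + m * p ≡ x + m * p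
    h₂ = solve-∀

  -- The term m δ arises when a chain of roots closes up modulo N; the condition on m says that
  -- translation by m N does not move x down.
  no-Rel₂ : ∀ f a c {x y z w} m → a ℕ.+ c ℕ.< f → x ≻ y → ¬ x ≈ y → z ≻ w → ¬ z ≈ w →
            ¬ x ≻ x + m * p → ¬ Rel₂ (+ suc a) x y (+ suc c) z w m
  no-Rel₂-chain : ∀ f a c {x y z} m → a ℕ.+ c ℕ.≤ f → z ≻ x → ¬ z ≈ x → x ≻ y → ¬ x ≈ y →
            ¬ x ≻ x + m * p → ¬ Rel₂ (+ suc a) x y (+ suc c) z x m

  no-Rel₂ (suc f) a c {x} {y} {z} {w} m (ℕ.s≤s le) x≻y x≉y z≻w z≉w W rel
    with align (Rel₂-cancels a c m (≻-nzˡ x≻y) x≉y rel) z≻w z≉w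
  ... | z′ , z′≻x , z′≉x , eq = no-Rel₂-chain f a c m le z′≻x z′≉x x≻y x≉y W
        (λ κ → trans (cong (λ X → + suc a * Δ x y κ + + suc c * X + m * D κ) (eq κ)) (rel κ))

  no-Rel₂-chain f a c {x} {y} {z} m le z≻x z≉x x≻y x≉y W rel with y ≈? z | ℕ.compare a c
  -- With equal coefficients A and z = y + dN the relation says A d + m = 0. But x + dN ≻ z ≻ x, so
  -- A translations by dN climb above x, and a final translation by mN yields x ≻ x + mN.
  ... | inj₁ (d , refl) | ℕ.equal .a = W (subst₂ _≻_ returns refl (≻-shift m (iterate x d climbs a)))
    where
    climbs : x + d * p ≻ x
    climbs = ≻-trans (≻-shift d x≻y) z≻x
    g : ∀ A d m D X Y → Y + X ≡ d * D → A * X + A * Y + m * D ≡ (A * d + m) * D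
    g A d m D X Y eq = trans (g₁ A X Y (m * D)) (trans (cong (λ Z → A * Z + m * D) eq) (g₂ A d m D))
      where
      g₁ : ∀ A X Y M → A * X + A * Y + M ≡ A * (Y + X) + M
      g₁ = solve-∀
      g₂ : ∀ A d m D → A * (d * D) + m * D ≡ (A * d + m) * D
      g₂ = solve-∀
    -- The coordinate `κ₀`, where δ is 1, turns the vector relation into an equation of integers.
    total : + suc a * d + m ≡ + 0
    total = begin
      + suc a * d + m               ≡⟨ sym (*-identityʳ _) ⟩
      (+ suc a * d + m) * + 1       ≡⟨ cong ((+ suc a * d + m) *_) (sym D-κ₀) ⟩
      (+ suc a * d + m) * D κ₀      ≡⟨ sym (g (+ suc a) d m (D κ₀) (Δ x y κ₀) (Δ (y + d * p) x κ₀)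
          (trans (Δ-add (y + d * p) x y κ₀) (Δ-δ y d κ₀))) ⟩
      + suc a * Δ x y κ₀ + + suc a * Δ (y + d * p) x κ₀ + m * D κ₀  ≡⟨ rel κ₀ ⟩
      + 0                           ∎
      where open ≡-Reasoning
    returns : x + (+ suc a * d) * p + m * p ≡ x
    returns = trans (h x (+ suc a * d) m p) (trans (cong (λ k → x + k * p) total) (h′ x p))
      where
      h : ∀ x k m p → x + k * p + m * p ≡ x + (k + m) * p
      h = solve-∀
      h′ : ∀ x p → x + + 0 * p ≡ x
      h′ = solve-∀
  ... | inj₁ (d , refl) | ℕ.less .a k = no-Rel₁ k (+ suc a * d + m) (≻-nzˡ z≻x) z≉x λ κ →
        trans (h (+ suc a) (+ suc k) (Δ x y κ) (Δ (y + d * p) x κ) d m (D κ)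
            (trans (Δ-add (y + d * p) x y κ) (Δ-δ y d κ)))
          (trans (cong (λ C → + suc a * Δ x y κ + C * Δ (y + d * p) x κ + m * D κ) (sym (split a k))) (rel κ))
    where
    h : ∀ A K X Y d m D → Y + X ≡ d * D → K * Y + (A * d + m) * D ≡ A * X + (A + K) * Y + m * D
    h A K X Y d m D eq = trans (h₁ A K Y d m D) (trans (cong (λ Z → K * Y + A * Z + m * D) (sym eq))
        (h₂ A K X Y (m * D)))
      where
      h₁ : ∀ A K Y d m D → K * Y + (A * d + m) * D ≡ K * Y + A * (d * D) + m * D
      h₁ = solve-∀
      h₂ : ∀ A K X Y M → K * Y + A * (Y + X) + M ≡ A * X + (A + K) * Y + M
      h₂ = solve-∀
  ... | inj₁ (d , refl) | ℕ.greater .c k = no-Rel₁ k (+ suc c * d + m) (≻-nzˡ x≻y) x≉y λ κ →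
        trans (h (+ suc c) (+ suc k) (Δ x y κ) (Δ (y + d * p) x κ) d m (D κ)
            (trans (Δ-add (y + d * p) x y κ) (Δ-δ y d κ)))
          (trans (cong (λ A → A * Δ x y κ + + suc c * Δ (y + d * p) x κ + m * D κ) (sym (split c k))) (rel κ))
    where
    h : ∀ C K X Y d m D → Y + X ≡ d * D → K * X + (C * d + m) * D ≡ (C + K) * X + C * Y + m * D
    h C K X Y d m D eq = trans (h₁ C K X d m D) (trans (cong (λ Z → K * X + C * Z + m * D) (sym eq))
        (h₂ C K X Y (m * D)))
      where
      h₁ : ∀ C K X d m D → K * X + (C * d + m) * D ≡ K * X + C * (d * D) + m * D
      h₁ = solve-∀
      h₂ : ∀ C K X Y M → K * X + C * (Y + X) + M ≡ (C + K) * X + C * Y + M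
      h₂ = solve-∀
  ... | inj₂ y≉z | ℕ.equal .a = no-Rel₁ a m (≻-nzˡ z≻x) (≉-sym y≉z) λ κ →
        trans (cong (λ Z → + suc a * Z + m * D κ) (sym (Δ-add z x y κ)))
            (trans (h (+ suc a) (Δ x y κ) (Δ z x κ) (m * D κ)) (rel κ))
    where
    h : ∀ A X Y M → A * (Y + X) + M ≡ A * X + A * Y + M
    h = solve-∀
  -- The remaining roots come from z ≻ x and z ≻ y. The first is negated so that the relation starts
  -- at -x, where the condition on `m` is available.
  ... | inj₂ y≉z | ℕ.less .a k = no-Rel₂ f k a m lt (≻-neg z≻x) (≉-neg z≉x) (≻-trans z≻x x≻y) (≉-sym y≉z)
        (¬-≻-neg m W) λ κ → trans (cong₂ (λ Y Z → + suc k * Y + + suc a * Z + m * D κ) (Δ-neg z x κ)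
            (sym (Δ-add z x y κ)))
          (trans (h (+ suc a) (+ suc k) (Δ x y κ) (Δ z x κ) (m * D κ))
            (trans (cong (λ C → + suc a * Δ x y κ + C * Δ z x κ + m * D κ) (sym (split a k))) (rel κ)))
    where
    h : ∀ A K X Y M → K * Y + A * (Y + X) + M ≡ A * X + (A + K) * Y + M
    h = solve-∀
    lt : k ℕ.+ a ℕ.< f
    lt = ℕ.≤-trans (ℕ.s≤s (ℕ.≤-reflexive (ℕ.+-comm k a))) (ℕ.≤-trans (ℕ.m≤n+m (suc (a ℕ.+ k)) a) le)
  ... | inj₂ y≉z | ℕ.greater .c k = no-Rel₂ f k c m lt x≻y x≉y (≻-trans z≻x x≻y) (≉-sym y≉z)
        W λ κ → trans (cong (λ Z → + suc k * Δ x y κ + + suc c * Z + m * D κ) (sym (Δ-add z x y κ)))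
          (trans (h (+ suc c) (+ suc k) (Δ x y κ) (Δ z x κ) (m * D κ))
            (trans (cong (λ A → A * Δ x y κ + + suc c * Δ z x κ + m * D κ) (sym (split c k))) (rel κ)))
    where
    h : ∀ C K X Y M → K * X + C * (Y + X) + M ≡ (C + K) * X + C * Y + M
    h = solve-∀
    lt : k ℕ.+ c ℕ.< f
    lt = ℕ.≤-trans (ℕ.s≤s (ℕ.≤-reflexive (ℕ.+-comm k c))) (ℕ.≤-trans (ℕ.m≤m+n (suc (c ℕ.+ k)) c) le)

  -- Another term must cancel the ẽ_x of the first, and `align` makes it z ≻ x. Merging z ≻ x ≻ y
  -- with the smaller of the two coefficients lowers the sum of the indices, which the fuel `f`
  -- bounds, or leaves at most two roots. If y ≡ z the merged pair is a multiple of δ, and at most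
  -- two roots together with that multiple remain.
  no-Rel₃ : ∀ f a b c {x y z w u v} → a ℕ.+ b ℕ.+ c ℕ.< f → x ≻ y → ¬ x ≈ y → z ≻ w → ¬ z ≈ w → u ≻ v → ¬ u ≈ v →
            ¬ Rel₃ (+ suc a) x y (+ suc b) z w (+ suc c) u v
  no-Rel₃-chain : ∀ f a b c {x y z u v} → a ℕ.+ b ℕ.+ c ℕ.≤ f → z ≻ x → ¬ z ≈ x → x ≻ y → ¬ x ≈ y → u ≻ v → ¬ u ≈ v →
            ¬ Rel₃ (+ suc a) x y (+ suc b) z x (+ suc c) u v

  no-Rel₃ (suc f) a b c {x} {y} {z} {w} {u} {v} (ℕ.s≤s le) x≻y x≉y z≻w z≉w u≻v u≉v rel
    with Rel₃-cancels a b c (≻-nzˡ x≻y) x≉y rel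
  ... | inj₁ canc with align canc z≻w z≉w
  ... | z′ , z′≻x , z′≉x , eq = no-Rel₃-chain f a b c le z′≻x z′≉x x≻y x≉y u≻v u≉v
        (λ κ → trans (cong (λ X → + suc a * Δ x y κ + + suc b * X + + suc c * Δ u v κ) (eq κ)) (rel κ))
  no-Rel₃ (suc f) a b c {x} {y} {z} {w} {u} {v} (ℕ.s≤s le) x≻y x≉y z≻w z≉w u≻v u≉v rel
      | inj₂ canc with align canc u≻v u≉v
  ... | u′ , u′≻x , u′≉x , eq = no-Rel₃-chain f a c b (subst (ℕ._≤ f) (swap a b c) le) u′≻x u′≉x x≻y x≉y z≻w z≉w
        (λ κ → trans (cong (λ X → + suc a * Δ x y κ + + suc c * X + + suc b * Δ z w κ) (eq κ))
                 (trans (h (+ suc a * Δ x y κ) (+ suc c * Δ u v κ) (+ suc b * Δ z w κ)) (rel κ)))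
    where
    h : ∀ A B C → A + B + C ≡ A + C + B
    h = solve-∀
    swap : ∀ a b c → a ℕ.+ b ℕ.+ c ≡ a ℕ.+ c ℕ.+ b
    swap a b c = trans (ℕ.+-assoc a b c) (trans (cong (a ℕ.+_) (ℕ.+-comm b c)) (sym (ℕ.+-assoc a c b)))

  no-Rel₃-chain f a b c {x} {y} {z} {u} {v} le z≻x z≉x x≻y x≉y u≻v u≉v rel with y ≈? z | ℕ.compare a b
  ... | inj₁ (d , refl) | ℕ.equal .a = no-Rel₁ c (+ suc a * d) (≻-nzˡ u≻v) u≉v λ κ →
        trans (h (+ suc a) d (D κ) (Δ x y κ) (Δ z x κ) (+ suc c * Δ u v κ) (trans (Δ-add z x y κ) (Δ-δ y d κ))) (rel κ)
    where
    h : ∀ A d D X Y Z → Y + X ≡ d * D → Z + (A * d) * D ≡ A * X + A * Y + Z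
    h A d D X Y Z eq = trans (cong (_+_ Z) (trans (*-assoc A d D) (cong (A *_) (sym eq)))) (g A X Y Z)
      where
      g : ∀ A X Y Z → Z + A * (Y + X) ≡ A * X + A * Y + Z
      g = solve-∀
  -- The merged part contributes A d δ. From z = y + dN and z ≻ y, translation by A d N moves every
  -- translate of y up, in particular z; this is the condition that `no-Rel₂` asks for.
  ... | inj₁ (d , refl) | ℕ.less .a k = no-Rel₂ (suc (k ℕ.+ c)) k c (+ suc a * d) ℕ.≤-refl z≻x z≉x u≻v u≉v
        (λ g → ≻-irrefl (≻-trans g (subst (_≻ z) (h y d (+ suc a * d) p)
            (≻-shift d (iterate y d (≻-trans z≻x x≻y) a)))))
        λ κ → trans (h′ (+ suc a) (+ suc k) d (D κ) (Δ x y κ) (Δ z x κ) (+ suc c * Δ u v κ)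
            (trans (Δ-add z x y κ) (Δ-δ y d κ)))
          (trans (cong (λ B → + suc a * Δ x y κ + B * Δ z x κ + + suc c * Δ u v κ) (sym (split a k))) (rel κ))
    where
    h : ∀ y d m p → y + m * p + d * p ≡ y + d * p + m * p
    h = solve-∀
    h′ : ∀ A K d D X Y Z → Y + X ≡ d * D → K * Y + Z + (A * d) * D ≡ A * X + (A + K) * Y + Z
    h′ A K d D X Y Z eq = trans (cong (_+_ (K * Y + Z)) (trans (*-assoc A d D) (cong (A *_) (sym eq)))) (g A K X Y Z)
      where
      g : ∀ A K X Y Z → K * Y + Z + A * (Y + X) ≡ A * X + (A + K) * Y + Z
      g = solve-∀
  -- The root of x ≻ y is negated to start at -y, since the climb is known at y.
  ... | inj₁ (d , refl) | ℕ.greater .b k = no-Rel₂ (suc (k ℕ.+ c)) k c (+ suc b * d) ℕ.≤-refl (≻-neg x≻y)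
      (≉-neg x≉y) u≻v u≉v
        (¬-≻-neg (+ suc b * d) (λ g → ≻-irrefl (≻-trans g (iterate y d (≻-trans z≻x x≻y) b))))
        λ κ → trans (cong (λ X → + suc k * X + + suc c * Δ u v κ + + suc b * d * D κ) (Δ-neg x y κ))
          (trans (h′ (+ suc b) (+ suc k) d (D κ) (Δ x y κ) (Δ z x κ) (+ suc c * Δ u v κ)
              (trans (Δ-add z x y κ) (Δ-δ y d κ)))
          (trans (cong (λ A → A * Δ x y κ + + suc b * Δ z x κ + + suc c * Δ u v κ) (sym (split b k))) (rel κ)))
    where
    h′ : ∀ B K d D X Y Z → Y + X ≡ d * D → K * X + Z + (B * d) * D ≡ (B + K) * X + B * Y + Z
    h′ B K d D X Y Z eq = trans (cong (_+_ (K * X + Z)) (trans (*-assoc B d D) (cong (B *_) (sym eq)))) (g B K X Y Z)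
      where
      g : ∀ B K X Y Z → K * X + Z + B * (Y + X) ≡ (B + K) * X + B * Y + Z
      g = solve-∀
  ... | inj₂ y≉z | ℕ.equal .a = no-Rel₂ (suc (a ℕ.+ c)) a c (+ 0) ℕ.≤-refl (≻-trans z≻x x≻y) (≉-sym y≉z) u≻v u≉v
        (λ g → ≻-irrefl (subst (z ≻_) (h z p) g))
        λ κ → trans (cong (λ X → + suc a * X + + suc c * Δ u v κ + + 0 * D κ) (sym (Δ-add z x y κ)))
          (trans (h′ (+ suc a) (D κ) (Δ x y κ) (Δ z x κ) (+ suc c * Δ u v κ)) (rel κ))
    where
    h : ∀ z p → z + + 0 * p ≡ z
    h = solve-∀
    h′ : ∀ A D X Y Z → A * (Y + X) + Z + + 0 * D ≡ A * X + A * Y + Z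
    h′ = solve-∀
  ... | inj₂ y≉z | ℕ.less .a k = no-Rel₃ f a k c lt (≻-trans z≻x x≻y) (≉-sym y≉z) z≻x z≉x u≻v u≉v
        λ κ → trans (cong (λ X → + suc a * X + + suc k * Δ z x κ + + suc c * Δ u v κ) (sym (Δ-add z x y κ)))
          (trans (h (+ suc a) (+ suc k) (Δ x y κ) (Δ z x κ) (+ suc c * Δ u v κ))
          (trans (cong (λ B → + suc a * Δ x y κ + B * Δ z x κ + + suc c * Δ u v κ) (sym (split a k))) (rel κ)))
    where
    h : ∀ A K X Y Z → A * (Y + X) + K * Y + Z ≡ A * X + (A + K) * Y + Z
    h = solve-∀
    lt : a ℕ.+ k ℕ.+ c ℕ.< f
    lt = ℕ.≤-trans (ℕ.+-monoˡ-≤ c (ℕ.m≤n+m (suc (a ℕ.+ k)) a)) le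
  ... | inj₂ y≉z | ℕ.greater .b k = no-Rel₃ f b k c lt (≻-trans z≻x x≻y) (≉-sym y≉z) x≻y x≉y u≻v u≉v
        λ κ → trans (cong (λ X → + suc b * X + + suc k * Δ x y κ + + suc c * Δ u v κ) (sym (Δ-add z x y κ)))
          (trans (h (+ suc b) (+ suc k) (Δ x y κ) (Δ z x κ) (+ suc c * Δ u v κ))
          (trans (cong (λ A → A * Δ x y κ + + suc b * Δ z x κ + + suc c * Δ u v κ) (sym (split b k))) (rel κ)))
    where
    h : ∀ B K X Y Z → B * (Y + X) + K * X + Z ≡ (B + K) * X + B * Y + Z
    h = solve-∀
    lt : b ℕ.+ k ℕ.+ c ℕ.< f
    lt = ℕ.≤-trans (ℕ.+-monoˡ-≤ c (ℕ.m≤m+n (suc (b ℕ.+ k)) b)) le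

  no-relation : ∀ a b c {x y z w u v} → x ≻ y → ¬ x ≈ y → z ≻ w → ¬ z ≈ w → u ≻ v → ¬ u ≈ v →
                ¬ Rel₃ (+ suc a) x y (+ suc b) z w (+ suc c) u v
  no-relation a b c = no-Rel₃ (suc (a ℕ.+ b ℕ.+ c)) a b c ℕ.≤-refl

-- Roots as pairs of integers, and their cones.

module RootSets (F : Frame) where
  open Frame F
  open Congruence F
  open Relations F

  record Root (i j : ℤ) : Set where
    constructor root
    field
      nzˡ : NZ i
      nzʳ : NZ j
      i≉j : ¬ i ≈ j
      i<j : i < j

  -- (i , j) stands for the root ẽ_j − ẽ_i: c (ẽ_t − ẽ_s) = a (ẽ_j − ẽ_i) + b (ẽ_l − ẽ_k) for some a, b, c > 0.
  record Cone (i j k l s t : ℤ) : Set where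
    constructor cone
    field
      root₁ : Root i j
      root₂ : Root k l
      root₃ : Root s t
      a b c : ℕ
      combination : ∀ κ → + suc c * Δ t s κ ≡ + suc a * Δ j i κ + + suc b * Δ l k κ

  record BiclosedPairs : Set₁ where
    field
      P : ℤ → ℤ → Set
      closed   : ∀ {i j k l s t} → Cone i j k l s t → P i j → P k l → P s t
      coclosed : ∀ {i j k l s t} → Cone i j k l s t → ¬ P i j → ¬ P k l → ¬ P s t

  -- The cone equation 2γ = α + α. Closedness under it makes a predicate on pairs depend only on the
  -- vector, which yields invariance under translation by N and under negation.
  same-root : ∀ {i j s t} → Root i j → Root s t → (∀ κ → Δ j i κ ≡ Δ t s κ) → Cone i j i j s t
  same-root r r′ eq = cone r r r′ 0 0 1 λ κ → trans (cong (+ 2 *_) (sym (eq κ))) (h _)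
    where
    h : ∀ X → + 2 * X ≡ + 1 * X + + 1 * X
    h = solve-∀

  Δ-swap : ∀ x y κ → Δ x y κ ≡ - Δ y x κ
  Δ-swap x y κ = h (E x κ) (E y κ)
    where
    h : ∀ x y → x - y ≡ - (y - x)
    h = solve-∀

  root-shift : ∀ {i j} d → Root i j → Root (i + d * p) (j + d * p)
  root-shift d (root nzi nzj i≉j i<j) =
    root (NZ-resp (≈-shift _ d) nzi) (NZ-resp (≈-shift _ d) nzj) (≉-shift d i≉j) (+-monoˡ-< (d * p) i<j)

  root-neg : ∀ {i j} → Root i j → Root (- j) (- i)
  root-neg (root nzi nzj i≉j i<j) = root (NZ-neg nzj) (NZ-neg nzi) (≉-neg i≉j) (neg-mono-< i<j)

  shift-< : ∀ i k → i < i + + suc k * p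
  shift-< i k = subst (_< i + + suc k * p) (+-identityʳ i)
    (+-monoʳ-< i (subst (_< + suc k * p) (*-zeroʳ (+ suc k)) (*-monoˡ-<-pos (+ suc k) p>0)))

  p≥1 : + 1 ≤ p
  p≥1 = i<j⇒suc[i]≤j p>0

  shift-past : ∀ i k → ∃[ m ] i < k + + suc m * p
  shift-past i k = m , (begin-strict
    i                     ≡⟨ h₁ k i ⟩
    k + (i - k)           ≤⟨ +-monoʳ-≤ k (i≤∣i∣ (i - k)) ⟩
    k + + m               <⟨ +-monoʳ-< k (+<+ ℕ.≤-refl) ⟩
    k + + suc m           ≡⟨ cong (_+_ k) (sym (*-identityʳ (+ suc m))) ⟩
    k + + suc m * + 1     ≤⟨ +-monoʳ-≤ k (*-monoˡ-≤-nonNeg (+ suc m) p≥1) ⟩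
    k + + suc m * p       ∎)
    where
    open ≤-Reasoning
    m = ∣ i - k ∣
    h₁ : ∀ k i → i ≡ k + (i - k)
    h₁ = solve-∀
    i≤∣i∣ : ∀ x → x ≤ + ∣ x ∣
    i≤∣i∣ (+ n) = ≤-refl
    i≤∣i∣ -[1+ n ] = -≤+

  ≈∧<⇒shift : ∀ {i j} → i ≈ j → i < j → ∃[ k ] j ≡ i + + suc k * p
  ≈∧<⇒shift (+ suc k , eq) _ = k , eq
  ≈∧<⇒shift {i} (+ 0 , refl) i<j = contradiction (subst (i <_) (+-identityʳ i) i<j) (<-irrefl refl)
  ≈∧<⇒shift {i} (-[1+ k ] , refl) i<j = contradiction i<j (<-asym
    (subst (i + -[1+ k ] * p <_) (h i (+ suc k) p) (shift-< (i + -[1+ k ] * p) k)))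
    where
    h : ∀ i k p → i + - k * p + k * p ≡ i
    h = solve-∀

  -- The tournament of a biclosed set and its extension by multiples of δ.

  module Tournament (B : BiclosedPairs) where
    open BiclosedPairs B

    infix 4 _≻_
    -- Because of the double negation in `if<`, the two directions of a pair are negations of each
    -- other, and `≻-flip` holds without deciding `P`. Congruent indices are left incomparable.
    record _≻_ (i j : ℤ) : Set where
      constructor above
      field
        nzˡ : NZ i
        nzʳ : NZ j
        i≉j : ¬ i ≈ j
        if< : i < j → ¬ ¬ P i j
        if> : j < i → ¬ P j i
    open _≻_

    P-resp : ∀ {i j s t} → Root i j → Root s t → (∀ κ → Δ j i κ ≡ Δ t s κ) → P i j → P s t
    P-resp r r′ eq Pij = closed (same-root r r′ eq) Pij Pij

    ≻-flip : ∀ {i j} → NZ i → NZ j → ¬ i ≈ j → ¬ i ≻ j → j ≻ i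
    ≻-flip nzi nzj i≉j i⊁j = above nzj nzi (≉-sym i≉j)
      (λ j<i ¬P → i⊁j (above nzi nzj i≉j (λ i<j → contradiction i<j (<-asym j<i)) (λ _ → ¬P)))
      (λ i<j Pij → i⊁j (above nzi nzj i≉j (λ _ ¬P → ¬P Pij) (λ j<i → contradiction i<j (<-asym j<i))))

    P⇒≻ : ∀ {i j} → Root i j → P i j → i ≻ j
    P⇒≻ (root nzi nzj i≉j i<j) Pij = above nzi nzj i≉j (λ _ ¬P → ¬P Pij) (λ j<i → contradiction i<j (<-asym j<i))

    ¬P⇒≻ : ∀ {i j} → Root i j → ¬ P i j → j ≻ i
    ¬P⇒≻ (root nzi nzj i≉j i<j) ¬P = above nzj nzi (≉-sym i≉j) (λ j<i → contradiction i<j (<-asym j<i)) (λ _ → ¬P)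

    rootˡ : ∀ {i j} → i ≻ j → i < j → Root i j
    rootˡ g i<j = root (nzˡ g) (nzʳ g) (i≉j g) i<j

    rootʳ : ∀ {i j} → i ≻ j → j < i → Root j i
    rootʳ g j<i = root (nzʳ g) (nzˡ g) (≉-sym (i≉j g)) j<i

    ≻-shift : ∀ {i j} d → i ≻ j → i + d * p ≻ j + d * p
    ≻-shift {i} {j} d g = above (NZ-resp (≈-shift i d) (nzˡ g)) (NZ-resp (≈-shift j d) (nzʳ g)) (≉-shift d (i≉j g))
      (λ lt ¬P → let i<j = unshift lt in if< g i<j (λ Pij → ¬P
         (P-resp (rootˡ g i<j) (root-shift d (rootˡ g i<j)) (λ κ → sym (Δ-shift j i d κ)) Pij)))
      (λ gt Pji → let j<i = unshift gt in if> g j<i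
         (P-resp (root-shift d (rootʳ g j<i)) (rootʳ g j<i) (Δ-shift i j d) Pji))
      where
      unshift : ∀ {i j} → i + d * p < j + d * p → i < j
      unshift {i} {j} lt = subst₂ _<_ (shift-cancel i d) (shift-cancel j d) (+-monoˡ-< (- d * p) lt)

    ≻-neg : ∀ {i j} → i ≻ j → - j ≻ - i
    ≻-neg {i} {j} g = above (NZ-neg (nzʳ g)) (NZ-neg (nzˡ g)) (≉-neg (i≉j g))
      (λ lt ¬P → let i<j = neg-cancel-< lt in if< g i<j (λ Pij → ¬P
         (P-resp (rootˡ g i<j) (root-neg (rootˡ g i<j)) (λ κ → sym (Δ-neg j i κ)) Pij)))
      (λ gt Pji → let j<i = neg-cancel-< gt in if> g j<i
         (P-resp (root-neg (rootʳ g j<i)) (rootʳ g j<i) (Δ-neg i j) Pji))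

    module _ (a b c : ℕ) {x y z w u v : ℤ} (x≻y : x ≻ y) (z≻w : z ≻ w) (u≻v : u ≻ v)
             (rel : Rel₃ (+ suc a) x y (+ suc b) z w (+ suc c) u v) where

      two-inversions : x < y → z < w → v < u → ⊥
      two-inversions x<y z<w v<u = if< x≻y x<y λ Pxy → if< z≻w z<w λ Pzw → if> u≻v v<u
        (closed (cone (rootˡ x≻y x<y) (rootˡ z≻w z<w) (rootʳ u≻v v<u) a b c comb) Pxy Pzw)
        where
        h : ∀ A X B Y C Z → A * X + B * Y + C * Z ≡ + 0 → C * Z ≡ A * - X + B * - Y
        h A X B Y C Z eq = trans (g A X B Y C Z) (trans (cong (_+ (A * - X + B * - Y)) eq) (+-identityˡ _))
          where
          g : ∀ A X B Y C Z → C * Z ≡ A * X + B * Y + C * Z + (A * - X + B * - Y)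
          g = solve-∀
        comb : ∀ κ → + suc c * Δ u v κ ≡ + suc a * Δ y x κ + + suc b * Δ w z κ
        comb κ = trans (h (+ suc a) (Δ x y κ) (+ suc b) (Δ z w κ) (+ suc c) (Δ u v κ) (rel κ))
          (cong₂ (λ X Y → + suc a * X + + suc b * Y) (sym (Δ-swap y x κ)) (sym (Δ-swap w z κ)))

      one-inversion : y < x → w < z → u < v → ⊥
      one-inversion y<x w<z u<v = if< u≻v u<v
        (coclosed (cone (rootʳ x≻y y<x) (rootʳ z≻w w<z) (rootˡ u≻v u<v) a b c comb) (if> x≻y y<x) (if> z≻w w<z))
        where
        h : ∀ A X B Y C Z → A * X + B * Y + C * Z ≡ + 0 → C * - Z ≡ A * X + B * Y
        h A X B Y C Z eq = trans (g A X B Y C Z) (trans (cong (λ S → A * X + B * Y - S) eq) (+-identityʳ _))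
          where
          g : ∀ A X B Y C Z → C * - Z ≡ A * X + B * Y - (A * X + B * Y + C * Z)
          g = solve-∀
        comb : ∀ κ → + suc c * Δ v u κ ≡ + suc a * Δ x y κ + + suc b * Δ z w κ
        comb κ = trans (cong (+ suc c *_) (Δ-swap v u κ)) (h (+ suc a) (Δ x y κ) (+ suc b) (Δ z w κ) (+ suc c)
            (Δ u v κ) (rel κ))

    Rel₃-rotate : ∀ A x y B z w C u v → Rel₃ A x y B z w C u v → Rel₃ B z w C u v A x y
    Rel₃-rotate A x y B z w C u v rel κ = trans (h (B * Δ z w κ) (C * Δ u v κ) (A * Δ x y κ)) (rel κ)
      where
      h : ∀ X Y Z → X + Y + Z ≡ Z + X + Y
      h = solve-∀

    ≻-cmp : ∀ {x y} → x ≻ y → x < y ⊎ y < x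
    ≻-cmp {x} {y} g with <-cmp x y
    ... | tri< lt _ _ = inj₁ lt
    ... | tri≈ _ refl _ = contradiction ≈-refl (i≉j g)
    ... | tri> _ _ gt = inj₂ gt

    -- If the three directions are not all equal, two agree, and their positive roots have the
    -- positive root of the third pair in their cone; closedness or coclosedness then contradicts
    -- the third. The last two hypotheses exclude three equal directions.
    no-mixed-relation : ∀ a b c {x y z w u v} → x ≻ y → z ≻ w → u ≻ v →
      Rel₃ (+ suc a) x y (+ suc b) z w (+ suc c) u v →
      (x < y → z < w → ¬ u < v) → (y < x → w < z → ¬ v < u) → ⊥
    no-mixed-relation a b c {x} {y} {z} {w} {u} {v} g₁ g₂ g₃ rel ¬< ¬> with ≻-cmp g₁ | ≻-cmp g₂ | ≻-cmp g₃
    ... | inj₁ l₁ | inj₁ l₂ | inj₁ l₃ = ¬< l₁ l₂ l₃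
    ... | inj₁ l₁ | inj₁ l₂ | inj₂ l₃ = two-inversions a b c g₁ g₂ g₃ rel l₁ l₂ l₃
    ... | inj₁ l₁ | inj₂ l₂ | inj₁ l₃ = two-inversions c a b g₃ g₁ g₂ rot₂ l₃ l₁ l₂
      where rot₂ = Rel₃-rotate (+ suc b) z w (+ suc c) u v (+ suc a) x y
                (Rel₃-rotate (+ suc a) x y (+ suc b) z w (+ suc c) u v rel)
    ... | inj₁ l₁ | inj₂ l₂ | inj₂ l₃ = one-inversion b c a g₂ g₃ g₁ rot l₂ l₃ l₁
      where rot = Rel₃-rotate (+ suc a) x y (+ suc b) z w (+ suc c) u v rel
    ... | inj₂ l₁ | inj₁ l₂ | inj₁ l₃ = two-inversions b c a g₂ g₃ g₁ rot l₂ l₃ l₁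
      where rot = Rel₃-rotate (+ suc a) x y (+ suc b) z w (+ suc c) u v rel
    ... | inj₂ l₁ | inj₁ l₂ | inj₂ l₃ = one-inversion c a b g₃ g₁ g₂ rot₂ l₃ l₁ l₂
      where rot₂ = Rel₃-rotate (+ suc b) z w (+ suc c) u v (+ suc a) x y
                (Rel₃-rotate (+ suc a) x y (+ suc b) z w (+ suc c) u v rel)
    ... | inj₂ l₁ | inj₂ l₂ | inj₁ l₃ = one-inversion a b c g₁ g₂ g₃ rel l₁ l₂ l₃
    ... | inj₂ l₁ | inj₂ l₂ | inj₂ l₃ = ¬> l₁ l₂ l₃

    acyclic : ∀ {x y z} → x ≻ y → y ≻ z → ¬ z ≻ x
    acyclic {x} {y} {z} x≻y y≻z z≻x = no-mixed-relation 0 0 0 x≻y y≻z z≻x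
      (λ κ → h (E x κ) (E y κ) (E z κ))
      (λ x<y y<z z<x → <-asym (<-trans x<y y<z) z<x)
      (λ y<x z<y x<z → <-asym (<-trans z<y y<x) x<z)
      where
      h : ∀ x y z → + 1 * (x - y) + + 1 * (y - z) + + 1 * (z - x) ≡ + 0
      h = solve-∀

    ≻-asym : ∀ {x y} → x ≻ y → ¬ y ≻ x
    ≻-asym g h with ≻-cmp g
    ... | inj₁ lt = if< g lt (if> h lt)
    ... | inj₂ gt = if< h gt (if> g gt)

    -- Up to the shift by one in the indices, ẽ_{x+sN} is the mean of ẽ_x and ẽ_{x+(s+t)N} with
    -- weights t and s. Subtracting ẽ_l throughout gives a vanishing positive combination, so three
    -- successive translates of `x` cannot lie above, below and above `l`.
    convex : ∀ s t {x l} → x ≻ l → l ≻ x + + suc s * p → ¬ x + + suc s * p + + suc t * p ≻ l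
    convex s t {x} {l} g₁ g₂ g₃ = no-mixed-relation t s (suc (s ℕ.+ t)) g₁ g₃ g₂
      (λ κ → trans (cong₂ (λ X Y → + suc t * Δ x l κ + + suc s * X + Y)
                      (cong (_- E l κ) (trans (E-shift _ (+ suc t) κ)
                          (cong (_+ + suc t * D κ) (E-shift x (+ suc s) κ))))
                      (cong₂ (λ C X → C * (E l κ - X)) (split s t) (E-shift x (+ suc s) κ)))
                   (h (+ suc s) (+ suc t) (E x κ) (E l κ) (D κ)))
      (λ _ gt lt → <-asym (<-trans gt lt) (shift-< _ t))
      (λ lt _ gt → <-asym (<-trans gt lt) (shift-< x s))
      where
      h : ∀ s t x l d → t * (x - l) + s * (x + s * d + t * d - l) + (s + t) * (l - (x + s * d)) ≡ + 0
      h = solve-∀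

    -- The pattern below, above, below, obtained by negation; this reverses the progression and
    -- exchanges `s` and `t`.
    convex′ : ∀ s t {x l} → l ≻ x → x + + suc s * p ≻ l → ¬ l ≻ x + + suc s * p + + suc t * p
    convex′ s t {x} {l} g₁ g₂ g₃ = convex t s (≻-neg g₃)
      (subst (- l ≻_) (h₁ x (+ suc s) (+ suc t) p) (≻-neg g₂))
      (subst (_≻ - l) (h₂ x (+ suc s) (+ suc t) p) (≻-neg g₁))
      where
      h₁ : ∀ x s t p → - (x + s * p) ≡ - (x + s * p + t * p) + t * p
      h₁ = solve-∀
      h₂ : ∀ x s t p → - x ≡ - (x + s * p + t * p) + t * p + s * p
      h₂ = solve-∀

    record Waning (i : ℤ) : Set where
      constructor waning
      field
        l  : ℤ
        d  : ℕ
        i≻l : i ≻ l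
        l≻i+d : l ≻ i + + suc d * p

    -- Both patterns persist to the common translate `i+`: `convex` gives `l ≻ i+` and `convex′`
    -- gives `i+ ≻ j`. As j ≻ i ≻ l forces j ≻ l, this is a cycle. If j is a translate of l the last
    -- comparison is missing; then the comparisons with j are translated to l, where they contradict
    -- asymmetry, `convex` or `convex′`.
    waning-not-waxing : ∀ {i j} → Waning i → ∀ s → j ≻ i → ¬ i + + suc s * p ≻ j
    waning-not-waxing {i} {j} (waning l d i≻l l≻i+d) s j≻i i+s≻j with l ≈? j
    ... | inj₂ l≉j = acyclic above-l above-j (≻-flip (nzʳ i≻l) (nzˡ j≻i) l≉j (acyclic j≻i i≻l))
      where
      i+ = i + + suc d * p + + suc s * p
      i≈i+ : i ≈ i+
      i≈i+ = ≈-trans (≈-shift i (+ suc d)) (≈-shift _ (+ suc s))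
      comm : i + + suc s * p + + suc d * p ≡ i+
      comm = h i (+ suc s) (+ suc d) p
        where
        h : ∀ i s d p → i + s * p + d * p ≡ i + d * p + s * p
        h = solve-∀
      above-l : l ≻ i+
      above-l = ≻-flip (NZ-resp i≈i+ (nzˡ i≻l)) (nzʳ i≻l) (λ h → i≉j i≻l (≈-trans i≈i+ h)) (convex d s i≻l l≻i+d)
      above-j : i+ ≻ j
      above-j = ≻-flip (nzˡ j≻i) (NZ-resp i≈i+ (nzˡ i≻l)) (λ h → i≉j j≻i (≈-trans h (≈-sym i≈i+)))
                  (λ g → convex′ s d j≻i i+s≻j (subst (j ≻_) (sym comm) g))
    ... | inj₁ (+ 0 , refl) = ≻-asym i≻l (subst (_≻ i) (+-identityʳ l) j≻i)
    ... | inj₁ (+ suc k , refl) = convex′ k d (subst (_≻ i-) (shift-cancel l (+ suc k)) (≻-shift (- + suc k) j≻i))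
        (subst (_≻ l) (sym i≡) i≻l) (subst (λ x → l ≻ x + + suc d * p) (sym i≡) l≻i+d)
      where
      i- = i + - + suc k * p
      i≡ : i- + + suc k * p ≡ i
      i≡ = shift-cancel i (- + suc k)
    ... | inj₁ (-[1+ k ] , refl) = convex k s i≻l
        (subst (_≻ i + + suc k * p) (shift-cancel l -[1+ k ]) (≻-shift (+ suc k) j≻i))
        (subst₂ _≻_ (h i (+ suc s) (+ suc k) p) (shift-cancel l -[1+ k ]) (≻-shift (+ suc k) i+s≻j))
      where
      h : ∀ i s k p → i + s * p + k * p ≡ i + k * p + s * p
      h = solve-∀

    waning-shift : ∀ {i} d → Waning i → Waning (i + d * p)
    waning-shift {i} d (waning l c i≻l l≻i+c) = waning (l + d * p) c (≻-shift d i≻l)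
      (subst (l + d * p ≻_) (h i (+ suc c) d p) (≻-shift d l≻i+c))
      where
      h : ∀ i c d p → i + c * p + d * p ≡ i + d * p + c * p
      h = solve-∀

    waning-neg : ∀ {i} → Waning i → Waning (- i)
    waning-neg {i} (waning l c i≻l l≻i+c) = waning (- l + + suc c * p) c
      (subst (_≻ - l + + suc c * p) (h i (+ suc c) p) (≻-shift (+ suc c) (≻-neg l≻i+c))) (≻-shift (+ suc c) (≻-neg i≻l))
      where
      h : ∀ i c p → - (i + c * p) + c * p ≡ - i
      h = solve-∀

    -- The multiple in `imaginary` is independent of the one inside `Waning i`: a single descent of
    -- `i` past some `l` adds the pairs of `i` with all its later translates.
    data Step (i j : ℤ) : Set where
      real : Root i j → P i j → Step i j
      imaginary : ∀ d → NZ i → j ≡ i + + suc d * p → Waning i → Step i j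

    step-< : ∀ {i j} → Step i j → i < j
    step-< (real r _) = Root.i<j r
    step-< {i} (imaginary d _ refl _) = shift-< i d

    step-nzˡ : ∀ {i j} → Step i j → NZ i
    step-nzˡ (real r _) = Root.nzˡ r
    step-nzˡ (imaginary _ nz _ _) = nz

    step-nzʳ : ∀ {i j} → Step i j → NZ j
    step-nzʳ (real r _) = Root.nzʳ r
    step-nzʳ {i} (imaginary d nz refl _) = NZ-resp (≈-shift i (+ suc d)) nz

    step-shift : ∀ {i j} d → Step i j → Step (i + d * p) (j + d * p)
    step-shift {i} {j} d (real r Pij) = real (root-shift d r)
        (P-resp r (root-shift d r) (λ κ → sym (Δ-shift j i d κ)) Pij)
    step-shift {i} d (imaginary c nz refl w) = imaginary c (NZ-resp (≈-shift i d) nz) (h i (+ suc c) d p)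
        (waning-shift d w)
      where
      h : ∀ i c d p → i + c * p + d * p ≡ i + d * p + c * p
      h = solve-∀

    step-neg : ∀ {i j} → Step i j → Step (- j) (- i)
    step-neg {i} {j} (real r Pij) = real (root-neg r) (P-resp r (root-neg r) (λ κ → sym (Δ-neg j i κ)) Pij)
    step-neg {i} s@(imaginary c nz refl w) = imaginary c (NZ-neg (step-nzʳ s)) (h i (+ suc c) p)
        (waning-neg (waning-shift (+ suc c) w))
      where
      h : ∀ i c p → - i ≡ - (i + c * p) + c * p
      h = solve-∀

    -- If j cuts an imaginary step at an index not congruent to i and both halves are missing, then
    -- k ≻ j ≻ i, against `waning-not-waxing`. If j cuts a real step and is congruent to one end,
    -- the missing half makes the opposite end the witness of waning. The remaining case is
    -- coclosedness.
    step-cotransitive : ∀ {i j k} → Step i k → NZ j → i < j → j < k → ¬ Step i j → ¬ Step j k → ⊥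
    step-cotransitive {i} {j} {k} (imaginary d nz refl w) nzj i<j j<k ¬ij ¬jk with i ≈? j
    ... | inj₁ i≈j = let c , eq = ≈∧<⇒shift i≈j i<j in ¬ij (imaginary c nz eq w)
    ... | inj₂ i≉j = waning-not-waxing w d (¬P⇒≻ r₁ (¬ij ∘ real r₁)) (¬P⇒≻ r₂ (¬jk ∘ real r₂))
      where
      r₁ = root nz nzj i≉j i<j
      r₂ = root nzj (NZ-resp (≈-shift i (+ suc d)) nz) (λ j≈k → i≉j (≈-trans (≈-shift i (+ suc d)) (≈-sym j≈k))) j<k
    step-cotransitive {i} {j} {k} (real r@(root nzi nzk i≉k i<k) Pik) nzj i<j j<k ¬ij ¬jk with i ≈? j | j ≈? k
    ... | inj₁ i≈j | _ with ≈∧<⇒shift i≈j i<j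
    ... | c , refl = ¬ij (imaginary c nzi refl (waning k c (P⇒≻ r Pik) (¬P⇒≻ r₂ (¬jk ∘ real r₂))))
      where r₂ = root nzj nzk (λ j≈k → i≉k (≈-trans i≈j j≈k)) j<k
    step-cotransitive {i} {j} {k} (real r@(root nzi nzk i≉k i<k) Pik) nzj i<j j<k ¬ij ¬jk
        | inj₂ i≉j | inj₁ j≈k with ≈∧<⇒shift j≈k j<k
    ... | c , refl = ¬jk (imaginary c nzj refl (waning i c (¬P⇒≻ r₁ (¬ij ∘ real r₁)) (P⇒≻ r Pik)))
      where r₁ = root nzi nzj i≉j i<j
    step-cotransitive {i} {j} {k} (real r@(root nzi nzk i≉k i<k) Pik) nzj i<j j<k ¬ij ¬jk
        | inj₂ i≉j | inj₂ j≉k =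
      coclosed (cone r₁ r₂ r 0 0 0 (λ κ → h (E i κ) (E j κ) (E k κ))) (¬ij ∘ real r₁) (¬jk ∘ real r₂) Pik
      where
      r₁ = root nzi nzj i≉j i<j
      r₂ = root nzj nzk j≉k j<k
      h : ∀ i j k → + 1 * (k - i) ≡ + 1 * (j - i) + + 1 * (k - j)
      h = solve-∀

  -- Paths of steps and the total order that they define.

  module Join (B₁ B₂ : BiclosedPairs) where
    module B₁ = BiclosedPairs B₁
    module B₂ = BiclosedPairs B₂
    module T₁ = Tournament B₁
    module T₂ = Tournament B₂

    data Closure (i j : ℤ) : Set where
      incl₁ : Root i j → B₁.P i j → Closure i j
      incl₂ : Root i j → B₂.P i j → Closure i j
      combine : ∀ {k l s t} → Cone k l s t i j → Closure k l → Closure s t → Closure i j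

    Step : ℤ → ℤ → Set
    Step i j = T₁.Step i j ⊎ T₂.Step i j

    infixr 5 _∷_
    data Path (i j : ℤ) : Set where
      [_] : Step i j → Path i j
      _∷_ : ∀ {k} → Step i k → Path k j → Path i j

    step-< : ∀ {i j} → Step i j → i < j
    step-< = [ T₁.step-< , T₂.step-< ]′

    path-< : ∀ {i j} → Path i j → i < j
    path-< [ s ] = step-< s
    path-< (s ∷ π) = <-trans (step-< s) (path-< π)

    infixr 5 _++_
    _++_ : ∀ {i j k} → Path i j → Path j k → Path i k
    [ s ] ++ ρ = s ∷ ρ
    (s ∷ π) ++ ρ = s ∷ (π ++ ρ)

    step-shift : ∀ {i j} d → Step i j → Step (i + d * p) (j + d * p)
    step-shift d = [ inj₁ ∘ T₁.step-shift d , inj₂ ∘ T₂.step-shift d ]′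

    step-neg : ∀ {i j} → Step i j → Step (- j) (- i)
    step-neg = [ inj₁ ∘ T₁.step-neg , inj₂ ∘ T₂.step-neg ]′

    path-shift : ∀ {i j} d → Path i j → Path (i + d * p) (j + d * p)
    path-shift d [ s ] = [ step-shift d s ]
    path-shift d (s ∷ π) = step-shift d s ∷ path-shift d π

    path-neg : ∀ {i j} → Path i j → Path (- j) (- i)
    path-neg [ s ] = [ step-neg s ]
    path-neg (s ∷ π) = path-neg π ++ [ step-neg s ]

    step-cotransitive : ∀ {i j k} → Step i k → NZ j → i < j → j < k → ¬ Step i j → ¬ Step j k → ⊥
    step-cotransitive (inj₁ s) nz l₁ l₂ ¬ij ¬jk = T₁.step-cotransitive s nz l₁ l₂ (¬ij ∘ inj₁) (¬jk ∘ inj₁)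
    step-cotransitive (inj₂ s) nz l₁ l₂ ¬ij ¬jk = T₂.step-cotransitive s nz l₁ l₂ (¬ij ∘ inj₂) (¬jk ∘ inj₂)

    -- Either j lies strictly inside one step, which is split there, or it is a vertex of the path,
    -- which then breaks at j.
    path-cotransitive : ∀ {i j k} → Path i k → NZ j → i < j → j < k → ¬ Path i j → ¬ Path j k → ⊥
    path-cotransitive [ s ] nz l₁ l₂ ¬ij ¬jk = step-cotransitive s nz l₁ l₂ (¬ij ∘ [_]) (¬jk ∘ [_])
    path-cotransitive {j = j} (_∷_ {m} s π) nz l₁ l₂ ¬ij ¬jk with <-cmp j m
    ... | tri< j<m _ _ = step-cotransitive s nz l₁ j<m (¬ij ∘ [_]) (¬jk ∘ (_∷ π))
    ... | tri≈ _ refl _ = ¬ij [ s ]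
    ... | tri> _ _ m<j = path-cotransitive π nz m<j l₂ (¬ij ∘ (s ∷_)) ¬jk

    infix 4 _≻_
    -- Distinct congruent indices are compared here as well, through imaginary steps; hence `i ≢ j`
    -- in place of incongruence.
    record _≻_ (i j : ℤ) : Set where
      constructor above
      field
        nzˡ : NZ i
        nzʳ : NZ j
        i≢j : i ≢ j
        if< : i < j → ¬ ¬ Path i j
        if> : j < i → ¬ Path j i
    open _≻_

    -- The inversion set criterion: where the three inequalities let two paths be joined, they are
    -- concatenated; where one path spans the other two pairs, `path-cotransitive` splits it.
    ≻-trans : ∀ {i j k} → i ≻ j → j ≻ k → i ≻ k
    ≻-trans {i} {j} {k} g h = above (nzˡ g) (nzʳ h) i≢k to from
      where
      i≢k : i ≢ k
      i≢k refl with <-cmp i j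
      ... | tri< i<j _ _ = if< g i<j (if> h i<j)
      ... | tri≈ _ i≡j _ = i≢j g i≡j
      ... | tri> _ _ j<i = if< h j<i (if> g j<i)
      to : i < k → ¬ ¬ Path i k
      to i<k ¬ik with <-cmp i j | <-cmp j k
      ... | tri≈ _ i≡j _ | _ = i≢j g i≡j
      ... | _ | tri≈ _ j≡k _ = i≢j h j≡k
      ... | tri< i<j _ _ | tri< j<k _ _ = if< g i<j λ π → if< h j<k λ ρ → ¬ik (π ++ ρ)
      ... | tri< i<j _ _ | tri> _ _ k<j = if< g i<j λ π → path-cotransitive π (nzʳ h) i<k k<j ¬ik (if> h k<j)
      ... | tri> _ _ j<i | tri< j<k _ _ = if< h j<k λ π → path-cotransitive π (nzˡ g) j<i i<k (if> g j<i) ¬ik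
      ... | tri> _ _ j<i | tri> _ _ k<j = <-asym i<k (<-trans k<j j<i)
      from : k < i → ¬ Path k i
      from k<i ki with <-cmp i j | <-cmp j k
      ... | tri≈ _ i≡j _ | _ = i≢j g i≡j
      ... | _ | tri≈ _ j≡k _ = i≢j h j≡k
      ... | tri< i<j _ _ | tri< j<k _ _ = <-asym k<i (<-trans i<j j<k)
      ... | tri< i<j _ _ | tri> _ _ k<j = if< g i<j λ π → if> h k<j (ki ++ π)
      ... | tri> _ _ j<i | tri< j<k _ _ = if< h j<k λ π → if> g j<i (π ++ ki)
      ... | tri> _ _ j<i | tri> _ _ k<j = path-cotransitive ki (nzʳ g) k<j j<i (if> h k<j) (if> g j<i)

    path-unshift : ∀ {i j} d → Path (i + d * p) (j + d * p) → Path i j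
    path-unshift {i} {j} d π = subst₂ Path (shift-cancel i d) (shift-cancel j d) (path-shift (- d) π)

    path-unneg : ∀ {i j} → Path (- j) (- i) → Path i j
    path-unneg {i} {j} π = subst₂ Path (neg-involutive i) (neg-involutive j) (path-neg π)

    order : InvariantOrder F
    order = record
      { _≻_ = _≻_ ; ≻-nzˡ = nzˡ ; ≻-nzʳ = nzʳ ; ≻-trans = ≻-trans ; ≻-irrefl = λ g → i≢j g refl
      ; ≻-shift = λ {i} {j} d g → above (NZ-resp (≈-shift i d) (nzˡ g)) (NZ-resp (≈-shift j d) (nzʳ g))
          (λ eq → i≢j g (trans (sym (shift-cancel i d)) (trans (cong (_+ - d * p) eq) (shift-cancel j d))))
          (λ lt ¬π → if< g (unshift d lt) (¬π ∘ path-shift d))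
          (λ gt π → if> g (unshift d gt) (path-unshift d π))
      ; ≻-neg = λ g → above (NZ-neg (nzʳ g)) (NZ-neg (nzˡ g)) (λ eq → i≢j g (sym (neg-injective eq)))
          (λ lt ¬π → if< g (neg-cancel-< lt) (¬π ∘ path-neg))
          (λ gt π → if> g (neg-cancel-< gt) (path-unneg π)) }
      where
      unshift : ∀ {i j} d → i + d * p < j + d * p → i < j
      unshift {i} {j} d lt = subst₂ _<_ (shift-cancel i d) (shift-cancel j d) (+-monoˡ-< (- d * p) lt)

    path⇒≻ : ∀ {i j} → Root i j → ¬ ¬ Path i j → i ≻ j
    path⇒≻ (root nzi nzj i≉j i<j) π = above nzi nzj (<⇒≢ i<j) (λ _ → π) (λ j<i → contradiction i<j (<-asym j<i))

    ¬path⇒≻ : ∀ {i j} → Root i j → ¬ Path i j → j ≻ i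
    ¬path⇒≻ (root nzi nzj i≉j i<j) ¬π = above nzj nzi (<⇒≢ i<j ∘ sym) (λ j<i → contradiction i<j (<-asym j<i))
        (λ _ → ¬π)

    open NoRelation order using (no-relation)

    cone-Rel₃ : ∀ {i j k l s t} (γ : Cone i j k l s t) → let open Cone γ in
      Rel₃ (+ suc a) i j (+ suc b) k l (+ suc c) t s
    cone-Rel₃ {i} {j} {k} {l} {s} {t} γ κ = trans
      (cong₂ _+_ (cong₂ (λ X Y → + suc a * X + + suc b * Y) (Δ-swap i j κ) (Δ-swap k l κ)) (combination κ))
      (h (+ suc a) (Δ j i κ) (+ suc b) (Δ l k κ))
      where
      open Cone γ
      h : ∀ A X B Y → A * - X + B * - Y + (A * X + B * Y) ≡ + 0
      h = solve-∀

    -- Were (s, t) not joined by a path, t ≻ s would hold, and the cone equation would become a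
    -- vanishing positive combination along the order. `path-coclosed` uses the negated equation.
    path-closed : ∀ {i j k l s t} → Cone i j k l s t → ¬ ¬ Path i j → ¬ ¬ Path k l → ¬ ¬ Path s t
    path-closed γ π ρ ¬st = no-relation a b c (path⇒≻ root₁ π) (Root.i≉j root₁) (path⇒≻ root₂ ρ) (Root.i≉j root₂)
      (¬path⇒≻ root₃ ¬st) (≉-sym (Root.i≉j root₃)) (cone-Rel₃ γ)
      where open Cone γ

    path-coclosed : ∀ {i j k l s t} → Cone i j k l s t → ¬ Path i j → ¬ Path k l → ¬ Path s t
    path-coclosed {i} {j} {k} {l} {s} {t} γ ¬ij ¬kl st = no-relation a b c
      (¬path⇒≻ root₁ ¬ij) (≉-sym (Root.i≉j root₁)) (¬path⇒≻ root₂ ¬kl) (≉-sym (Root.i≉j root₂))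
      (path⇒≻ root₃ (λ ¬st → ¬st st)) (Root.i≉j root₃)
      (λ κ → trans (cong₂ _+_ (cong₂ (λ X Y → + suc a * X + + suc b * Y) (Δ-swap j i κ) (Δ-swap l k κ))
          (cong (+ suc c *_) (Δ-swap s t κ)))
        (trans (h (+ suc a) (Δ i j κ) (+ suc b) (Δ k l κ) (+ suc c) (Δ t s κ)) (cong -_ (cone-Rel₃ γ κ))))
      where
      open Cone γ
      h : ∀ A X B Y C Z → A * - X + B * - Y + C * - Z ≡ - (A * X + B * Y + C * Z)
      h = solve-∀

    -- Agreement of cone closure and paths on roots, up to double negation.

    closure⇒path : ∀ {i j} → Closure i j → ¬ ¬ Path i j
    closure⇒path (incl₁ r Pij) ¬π = ¬π [ inj₁ (T₁.real r Pij) ]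
    closure⇒path (incl₂ r Pij) ¬π = ¬π [ inj₂ (T₂.real r Pij) ]
    closure⇒path (combine γ x y) = path-closed γ (closure⇒path x) (closure⇒path y)

    closure-root : ∀ {i j} → Closure i j → Root i j
    closure-root (incl₁ r _) = r
    closure-root (incl₂ r _) = r
    closure-root (combine γ _ _) = Cone.root₃ γ

    closure-resp : ∀ {i j s t} → Root s t → (∀ κ → Δ j i κ ≡ Δ t s κ) → Closure i j → Closure s t
    closure-resp r eq x = combine (same-root (closure-root x) r eq) x x

    closure-neg : ∀ {i j} → Closure i j → Closure (- j) (- i)
    closure-neg {i} {j} x = closure-resp (root-neg (closure-root x)) (λ κ → sym (Δ-neg j i κ)) x

    closure-trans : ∀ {i j k} → ¬ i ≈ k → Closure i j → Closure j k → Closure i k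
    closure-trans {i} {j} {k} i≉k x y = combine
      (cone r₁ r₂ (root (Root.nzˡ r₁) (Root.nzʳ r₂) i≉k (<-trans (Root.i<j r₁) (Root.i<j r₂))) 0 0 0
        (λ κ → h (E i κ) (E j κ) (E k κ))) x y
      where
      r₁ = closure-root x
      r₂ = closure-root y
      h : ∀ i j k → + 1 * (k - i) ≡ + 1 * (j - i) + + 1 * (k - j)
      h = solve-∀

    -- With s and t the positive multiples, the given roots α and β satisfy α + β = sδ and the new
    -- root is α + tδ; thus s times it is (s + t)α + tβ.
    closure-δ : ∀ {i j} s t → Closure i j → Closure j (i + + suc s * p) → Closure i (j + + suc t * p)
    closure-δ {i} {j} s t x y = combine (cone r (closure-root y) r′ (suc (s ℕ.+ t)) t s comb) x y
      where
      r = closure-root x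
      r′ = root (Root.nzˡ r) (NZ-resp (≈-shift j (+ suc t)) (Root.nzʳ r))
             (λ h → Root.i≉j r (≈-trans h (≈-sym (≈-shift j (+ suc t))))) (<-trans (Root.i<j r) (shift-< j t))
      h : ∀ s t i j d → s * (j + t * d - i) ≡ (s + t) * (j - i) + t * (i + s * d - j)
      h = solve-∀
      comb : ∀ κ → + suc s * Δ (j + + suc t * p) i κ ≡ + suc (suc (s ℕ.+ t)) * Δ j i κ + + suc t * Δ
          (i + + suc s * p) j κ
      comb κ = trans (cong (λ X → + suc s * (X - E i κ)) (E-shift j (+ suc t) κ))
        (trans (h (+ suc s) (+ suc t) (E i κ) (E j κ) (D κ))
          (cong₂ (λ C X → C * Δ j i κ + + suc t * (X - E j κ)) (sym (split s t)) (sym (E-shift i (+ suc s) κ))))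

    module Extend (B : BiclosedPairs) (incl : ∀ {i j} → Root i j → BiclosedPairs.P B i j → Closure i j) where
      module T = Tournament B
      open T using (Waning; waning-not-waxing; waning-neg; waning-shift; ¬P⇒≻)

      -- Suppose the conclusion fails. Then `B` contains neither (h, i + dN) nor, by `closure-δ`,
      -- (i, h + mN), where m is large enough to make the latter pair increasing. Hence i + (d + m)N
      -- ≻ h + mN ≻ i, which a waning `i` forbids. The index `d + suc m` encodes the sum of the two
      -- positive multiples.
      extendʳ : ∀ {h i} d → Waning i → Closure h i → ¬ ¬ Closure h (i + + suc d * p)
      extendʳ {h} {i} d w x ¬x with shift-past i h
      ... | m , i<h+m = waning-not-waxing w (d ℕ.+ suc m)
            (¬P⇒≻ r₂ (λ P₂ → ¬x (closure-δ m d x (incl r₂ P₂))))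
            (subst (T._≻ h + + suc m * p) (lemma i (+ suc d) (+ suc m) p)
                (T.≻-shift (+ suc m) (¬P⇒≻ r₁ (¬x ∘ incl r₁))))
        where
        r = closure-root x
        r₁ = root (Root.nzˡ r) (NZ-resp (≈-shift i (+ suc d)) (Root.nzʳ r))
               (λ e → Root.i≉j r (≈-trans e (≈-sym (≈-shift i (+ suc d))))) (<-trans (Root.i<j r) (shift-< i d))
        r₂ = root (Root.nzʳ r) (NZ-resp (≈-shift h (+ suc m)) (Root.nzˡ r))
               (λ e → Root.i≉j r (≈-trans (≈-shift h (+ suc m)) (≈-sym e))) i<h+m
        lemma : ∀ i d m p → i + d * p + m * p ≡ i + (d + m) * p
        lemma = solve-∀

      -- The mirror image of `extendʳ` under negation; the waning index becomes the negative of the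
      -- translate.
      extendˡ : ∀ {i k} d → Waning i → Closure (i + + suc d * p) k → ¬ ¬ Closure i k
      extendˡ {i} {k} d w x ¬x = extendʳ d (waning-neg (waning-shift (+ suc d) w)) (closure-neg x)
        λ y → ¬x (closure-resp r (λ κ → trans (cong (λ j → Δ j (- k) κ) (lemma i (+ suc d) p)) (Δ-neg k i κ)) y)
        where
        r′ = closure-root x
        r = root (NZ-resp (≈-sym (≈-shift i (+ suc d))) (Root.nzˡ r′)) (Root.nzʳ r′)
              (λ e → Root.i≉j r′ (≈-trans (≈-sym (≈-shift i (+ suc d))) e)) (<-trans (shift-< i d) (Root.i<j r′))
        lemma : ∀ i d p → - (i + d * p) + d * p ≡ - i
        lemma = solve-∀

      step⇒closure : ∀ {i j} → ¬ i ≈ j → T.Step i j → Closure i j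
      step⇒closure i≉j (T.real r Pij) = incl r Pij
      step⇒closure {i} i≉j (T.imaginary d _ refl _) = contradiction (≈-shift i (+ suc d)) i≉j

      step-extendʳ : ∀ {h i j} → i ≈ j → T.Step i j → Closure h i → ¬ ¬ Closure h j
      step-extendʳ i≈j (T.real r _) = contradiction i≈j (Root.i≉j r)
      step-extendʳ i≈j (T.imaginary d _ refl w) = extendʳ d w

      step-extendˡ : ∀ {i j k} → i ≈ j → T.Step i j → Closure j k → ¬ ¬ Closure i k
      step-extendˡ i≈j (T.real r _) = contradiction i≈j (Root.i≉j r)
      step-extendˡ i≈j (T.imaginary d _ refl w) = extendˡ d w

    module X₁ = Extend B₁ incl₁
    module X₂ = Extend B₂ incl₂

    step⇒closure : ∀ {i j} → ¬ i ≈ j → Step i j → Closure i j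
    step⇒closure i≉j = [ X₁.step⇒closure i≉j , X₂.step⇒closure i≉j ]′

    step-extendʳ : ∀ {h i j} → i ≈ j → Step i j → Closure h i → ¬ ¬ Closure h j
    step-extendʳ i≈j = [ X₁.step-extendʳ i≈j , X₂.step-extendʳ i≈j ]′

    step-extendˡ : ∀ {i j k} → i ≈ j → Step i j → Closure j k → ¬ ¬ Closure i k
    step-extendˡ i≈j = [ X₁.step-extendˡ i≈j , X₂.step-extendˡ i≈j ]′

    -- `Closure` holds roots only, so an imaginary step is absorbed into the root before or after
    -- it. `path-extendʳ` carries the root accumulated so far.
    path⇒closure : ∀ {i k} → ¬ i ≈ k → Path i k → ¬ ¬ Closure i k
    path-extendʳ : ∀ {h i k} → ¬ h ≈ k → Closure h i → Path i k → ¬ ¬ Closure h k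

    path⇒closure i≉k [ s ] ¬x = ¬x (step⇒closure i≉k s)
    path⇒closure {i} i≉k (_∷_ {m} s π) with i ≈? m
    ... | inj₂ i≉m = path-extendʳ i≉k (step⇒closure i≉m s) π
    ... | inj₁ i≈m = λ ¬x → path⇒closure (λ m≈k → i≉k (≈-trans i≈m m≈k)) π (λ y → step-extendˡ i≈m s y ¬x)

    path-extendʳ {i = i} {k} h≉k x [ s ] with i ≈? k
    ... | inj₁ i≈k = step-extendʳ i≈k s x
    ... | inj₂ i≉k = λ ¬x → ¬x (closure-trans h≉k x (step⇒closure i≉k s))
    path-extendʳ {h} {i} {k} h≉k x (_∷_ {m} s π) with i ≈? m | h ≈? m
    ... | inj₁ i≈m | _ = λ ¬x → step-extendʳ i≈m s x (λ y → path-extendʳ h≉k y π ¬x)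
    ... | inj₂ i≉m | inj₂ h≉m = path-extendʳ h≉k (closure-trans h≉m x (step⇒closure i≉m s)) π
    -- The roots of (h, i) and (i, m) add up to a multiple of δ, so they cannot be merged yet; the
    -- rest of the path is turned into a root from m first.
    ... | inj₂ i≉m | inj₁ h≈m = λ ¬x → path⇒closure (λ m≈k → h≉k (≈-trans h≈m m≈k)) π (λ z → last z ¬x)
      where
      y = step⇒closure i≉m s
      last : Closure m k → ¬ ¬ Closure h k
      last z with i ≈? k
      ... | inj₂ i≉k = λ ¬x → ¬x (closure-trans h≉k x (closure-trans i≉k y z))
      -- Now (i, m) and (m, k) do not merge either. Since m and k are translates of h and i, the
      -- wanted root is that of (h, i) plus a multiple of δ.
      ... | inj₁ i≈k with ≈∧<⇒shift h≈m (<-trans (Root.i<j (closure-root x)) (step-< s))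
                        | ≈∧<⇒shift i≈k (<-trans (step-< s) (Root.i<j (closure-root z)))
      ... | c , refl | d , refl = λ ¬x → ¬x (closure-δ c d x y)

    -- The goal is a negation, so the double negations in the passage to paths and back can be
    -- discharged.
    closure-coclosed : ∀ {i j k l s t} → Cone i j k l s t → ¬ Closure i j → ¬ Closure k l → ¬ Closure s t
    closure-coclosed γ ¬x ¬y z = closure⇒path z (path-coclosed γ
      (λ π → path⇒closure (Root.i≉j root₁) π ¬x) (λ π → path⇒closure (Root.i≉j root₂) π ¬y))
      where open Cone γ

-- Biclosed sets of vectors, their joins and meets.

module BiclosedSets (n : ℕ) where
  open AffineC n using (frame; ≈⇒∣; ∣⇒≈)
  open Frame frame using (_≈_; NZ)
  open Congruence frame using (Δ)
  open RootSets frame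

  vec : ℤ → ℤ → V n
  vec i j = e n j ⊝ e n i

  ∤⇒NZ : ∀ {i} → ¬ (+ N n Unsigned.∣ i) → NZ i
  ∤⇒NZ {i} N∤i h = N∤i (subst (+ N n Unsigned.∣_) (+-identityʳ i) (≈⇒∣ h))

  NZ⇒∤ : ∀ {i} → NZ i → ¬ (+ N n Unsigned.∣ i)
  NZ⇒∤ {i} nz h = nz (∣⇒≈ (subst (+ N n Unsigned.∣_) (sym (+-identityʳ i)) h))

  root⇒posRoot : ∀ {i j} → Root i j → PosRoot n (vec i j)
  root⇒posRoot {i} {j} (root nzi nzj i≉j i<j) = i , j , NZ⇒∤ nzi , NZ⇒∤ nzj , i≉j ∘ ∣⇒≈ , i<j , refl

  posRoot⇒root : ∀ {v} → PosRoot n v → ∃[ i ] ∃[ j ] Root i j × v ≡ vec i j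
  posRoot⇒root (i , j , N∤i , N∤j , N∤j-i , i<j , eq) =
    i , j , root (∤⇒NZ N∤i) (∤⇒NZ N∤j) (N∤j-i ∘ ≈⇒∣) i<j , eq

  lookup-vec : ∀ a i j κ → lookup ((+ suc a) · vec i j) κ ≡ + suc a * Δ j i κ
  lookup-vec a i j κ = trans (lookup-· (+ suc a) (vec i j) κ) (cong (+ suc a *_) (lookup-⊝ (e n j) (e n i) κ))

  lookup-sum : ∀ a b i j k l κ → lookup (((+ suc a) · vec i j) ⊕ ((+ suc b) · vec k l)) κ ≡ + suc a * Δ j i
      κ + + suc b * Δ l k κ
  lookup-sum a b i j k l κ = trans (lookup-⊕ ((+ suc a) · vec i j) ((+ suc b) · vec k l) κ)
    (cong₂ _+_ (lookup-vec a i j κ) (lookup-vec b k l κ))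

  cone⇒inCone : ∀ {i j k l s t} → Cone i j k l s t → InCone n (vec s t) (vec i j) (vec k l)
  cone⇒inCone {i} {j} {k} {l} {s} {t} γ = a , b , c , lookup-ext λ κ →
    trans (lookup-vec c s t κ) (trans (combination κ) (sym (lookup-sum a b i j k l κ)))
    where open Cone γ

  inCone⇒cone : ∀ {i j k l s t} → Root i j → Root k l → Root s t →
                InCone n (vec s t) (vec i j) (vec k l) → Cone i j k l s t
  inCone⇒cone {i} {j} {k} {l} {s} {t} r₁ r₂ r₃ (a , b , c , eq) = cone r₁ r₂ r₃ a b c λ κ →
    trans (sym (lookup-vec c s t κ)) (trans (cong (λ v → lookup v κ) eq) (lookup-sum a b i j k l κ))

  module _ {B : Pred (V n) 0ℓ} (bic : Biclosed n B) where

    cone-closed : ∀ {i j k l s t} → Cone i j k l s t →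
      (B (vec i j) → B (vec k l) → B (vec s t)) × (¬ B (vec i j) → ¬ B (vec k l) → ¬ B (vec s t))
    cone-closed γ = proj₂ bic _ _ _ (root⇒posRoot root₁) (root⇒posRoot root₂) (root⇒posRoot root₃) (cone⇒inCone γ)
      where open Cone γ

    pairs : BiclosedPairs
    pairs = record { P = λ i j → B (vec i j) ; closed = proj₁ ∘ cone-closed ; coclosed = proj₂ ∘ cone-closed }

    -- Complementation exchanges the two conditions; this is how the meet is reduced to a closure.
    complementPairs : BiclosedPairs
    complementPairs = record
      { P = λ i j → ¬ B (vec i j)
      ; closed = proj₂ ∘ cone-closed
      ; coclosed = λ γ ¬¬x ¬¬y ¬z → ¬¬x λ x → ¬¬y λ y → ¬z (proj₁ (cone-closed γ) x y) }

  module Generated (Q₁ Q₂ : BiclosedPairs) where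
    open Join Q₁ Q₂

    Gen : Pred (V n) 0ℓ
    Gen v = ∃[ i ] ∃[ j ] v ≡ vec i j × Closure i j

    gen-biclosed : Biclosed n Gen
    gen-biclosed = ⊆-posRoot , λ α β γ α∈ β∈ γ∈ inC → closed α∈ β∈ γ∈ inC , coclosed α∈ β∈ γ∈ inC
      where
      ⊆-posRoot : Gen ⊆ PosRoot n
      ⊆-posRoot (i , j , refl , x) = root⇒posRoot (closure-root x)
      closed : ∀ {α β γ} → PosRoot n α → PosRoot n β → PosRoot n γ → InCone n γ α β → Gen α → Gen β → Gen γ
      closed _ _ γ∈ inC (i , j , refl , x) (k , l , refl , y) with posRoot⇒root γ∈
      ... | s , t , r , refl = s , t , refl , combine (inCone⇒cone (closure-root x) (closure-root y) r inC) x y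
      coclosed : ∀ {α β γ} → PosRoot n α → PosRoot n β → PosRoot n γ → InCone n γ α β → ¬ Gen α → ¬ Gen β → ¬ Gen γ
      coclosed α∈ β∈ _ inC ¬α ¬β (s , t , refl , z) with posRoot⇒root α∈ | posRoot⇒root β∈
      ... | i , j , r₁ , refl | k , l , r₂ , refl = closure-coclosed (inCone⇒cone r₁ r₂ (closure-root z) inC)
            (λ x → ¬α (i , j , refl , x)) (λ y → ¬β (k , l , refl , y)) z

  join : ∀ {B₁ B₂ : Pred (V n) 0ℓ} → Biclosed n B₁ → Biclosed n B₂ → ∃[ J ] IsJoin n B₁ B₂ J
  join {B₁} {B₂} bic₁ bic₂ = Gen , gen-biclosed , left , right , least
    where
    open Join (pairs bic₁) (pairs bic₂)
    open Generated (pairs bic₁) (pairs bic₂)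
    left : B₁ ⊆ Gen
    left v∈ with posRoot⇒root (proj₁ bic₁ v∈)
    ... | i , j , r , refl = i , j , refl , incl₁ r v∈
    right : B₂ ⊆ Gen
    right v∈ with posRoot⇒root (proj₁ bic₂ v∈)
    ... | i , j , r , refl = i , j , refl , incl₂ r v∈
    least : ∀ K → Biclosed n K → B₁ ⊆ K → B₂ ⊆ K → Gen ⊆ K
    least K bicK B₁⊆K B₂⊆K (i , j , refl , x) = go x
      where
      go : ∀ {i j} → Closure i j → K (vec i j)
      go (incl₁ _ x) = B₁⊆K x
      go (incl₂ _ x) = B₂⊆K x
      go (combine γ x y) = proj₁ (cone-closed bicK γ) (go x) (go y)

  meet : ∀ {B₁ B₂ : Pred (V n) 0ℓ} → Biclosed n B₁ → Biclosed n B₂ → ∃[ M ] IsMeet n B₁ B₂ M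
  meet {B₁} {B₂} bic₁ bic₂ = M , (proj₁ bic₁ ∘ proj₁ , biclosed) , proj₁ , proj₁ ∘ proj₂ , greatest
    where
    open Join (complementPairs bic₁) (complementPairs bic₂)
    open Generated (complementPairs bic₁) (complementPairs bic₂)
    M : Pred (V n) 0ℓ
    -- Classically this is the complement of the closure of the two complements. On roots `¬ Gen v`
    -- yields only the double negations of `B₁ v` and `B₂ v`, so both are recorded.
    M v = B₁ v × B₂ v × ¬ Gen v
    ¬M⇒Gen : ∀ {v} → PosRoot n v → ¬ M v → ¬ ¬ Gen v
    ¬M⇒Gen v∈ ¬M ¬gen with posRoot⇒root v∈
    ... | i , j , r , refl = ¬gen (i , j , refl , incl₁ r λ x₁ → ¬gen
        (i , j , refl , incl₂ r λ x₂ → ¬M (x₁ , x₂ , ¬gen)))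
    biclosed : ∀ α β γ → PosRoot n α → PosRoot n β → PosRoot n γ → InCone n γ α β →
               (M α → M β → M γ) × (¬ M α → ¬ M β → ¬ M γ)
    biclosed α β γ α∈ β∈ γ∈ inC =
      (λ (x₁ , x₂ , x) (y₁ , y₂ , y) → proj₁ (proj₂ bic₁ α β γ α∈ β∈ γ∈ inC) x₁ y₁ ,
        proj₁ (proj₂ bic₂ α β γ α∈ β∈ γ∈ inC) x₂ y₂ , proj₂ (proj₂ gen-biclosed α β γ α∈ β∈ γ∈ inC) x y) ,
      (λ ¬x ¬y (_ , _ , ¬z) → ¬M⇒Gen α∈ ¬x λ x → ¬M⇒Gen β∈ ¬y λ y →
        ¬z (proj₁ (proj₂ gen-biclosed α β γ α∈ β∈ γ∈ inC) x y))
    greatest : ∀ K → Biclosed n K → K ⊆ B₁ → K ⊆ B₂ → K ⊆ M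
    greatest K bicK K⊆B₁ K⊆B₂ x = K⊆B₁ x , K⊆B₂ x , λ { (i , j , refl , z) → go z x }
      where
      -- The complement of `K` contains both complements and, by coclosedness of `K`, all that they
      -- generate.
      go : ∀ {i j} → Closure i j → ¬ K (vec i j)
      go (incl₁ _ x∉) = x∉ ∘ K⊆B₁
      go (incl₂ _ x∉) = x∉ ∘ K⊆B₂
      go (combine γ x y) = proj₂ (cone-closed bicK γ) (go x) (go y)

theorem5p11 : (n : ℕ) → n ≥ 1 → (B₁ B₂ : Pred (V n) 0ℓ) → Biclosed n B₁ → Biclosed n B₂ →
    (∃[ J ] IsJoin n B₁ B₂ J) × (∃[ M ] IsMeet n B₁ B₂ M)
theorem5p11 n _ B₁ B₂ bic₁ bic₂ = BiclosedSets.join n bic₁ bic₂ , BiclosedSets.meet n bic₁ bic₂
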